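{- There is a computable linear order $\mathcal{L}$ of order type $\omega$ with a non-computable successor function such that for every cohesive set $C\subseteq\omega$ we have $\Pi_C\mathcal{L}\cong\mathbb{N}+\mathbb{Q}\times\mathbb{Z}$.
   Context: $\omega$ denotes the set of natural numbers. $X\subseteq^* Y$ means that $X\setminus Y$ is finite. An infinite set $C\subseteq\omega$ is cohesive if for every c.e. set $W$, either $W\cap C$ or $\overline{W}\cap C$ is finite. Linear orders are strict. A computable linear order $\mathcal{L}=(L,<_{\mathcal{L}})$ is one whose domain $L$ is a computable subset of $\omega$ and whose relation $<_{\mathcal{L}}$ is computable. It has order type $\omega$ if it is isomorphic to $\mathbb{N}$ with its usual order; its successor function then sends each element to its immediate successor with respect to $<_{\mathcal{L}}$. Cohesive power: for a cohesive set $C$ and a computable linear order $\mathcal{L}=(L,<_{\mathcal{L}})$, let $D$ be the set of partial computable functions $\varphi:\omega\to L$ with $C\subseteq^*\mathrm{dom}(\varphi)$. For $\varphi,\psi\in D$ put $\varphi=_C\psi$ iff $C\subseteq^*\{x:\varphi(x){\downarrow}=\psi(x){\downarrow}\}$. The cohesive power $\Pi_C\mathcal{L}$ has domain $D/{=_C}$, with $[\varphi]<[\psi]$ iff $C\subseteq^*\{x:\varphi(x){\downarrow}<_{\mathcal{L}}\psi(x){\downarrow}\}$. $\mathbb{N},\mathbb{Z},\mathbb{Q}$ denote the usual ordered sets. $+$ is the sum of linear orders (first summand placed below the second) and $\mathcal{L}_0\times\mathcal{L}_1$ is the lexicographical product, with $\langle k,m\rangle<\langle l,n\rangle$ iff $k<_{\mathcal{L}_0}l$,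 or $k=l$ and $m<_{\mathcal{L}_1}n$. Thus $\mathbb{N}+\mathbb{Q}\times\mathbb{Z}$ is a copy of $\mathbb{N}$ followed by densely ordered (indexed by $\mathbb{Q}$) copies of $\mathbb{Z}$. -}

module Defs where

open import Data.Fin.Base using (Fin)
import Data.Integer.Properties as ℤ
open import Data.Nat.Base using (ℕ; zero; suc; _<_)
open import Data.Nat.InfinitelyOften using () renaming (Fin to Finite; Inf to Infinite)
import Data.Nat.Properties as ℕ
open import Data.Product.Base using (Σ; ∃; ∃₂; _×_; proj₁)
open import Data.Product.Relation.Binary.Lex.Strict using (×-strictTotalOrder)
import Data.Rational.Properties as ℚ
open import Data.Sum.Base using (_⊎_)
open import Data.Sum.Relation.Binary.LeftOrder using (⊎-<-strictTotalOrder)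
open import Data.Vec.Base using (Vec; []; _∷_; lookup)
open import Data.Vec.Relation.Binary.Pointwise.Inductive using (Pointwise)
open import Function.Base using (_on_)
open import Level using (0ℓ)
open import Relation.Binary.Bundles using (StrictTotalOrder)
open import Relation.Binary.Bundles.Raw using (RawRelation)
open import Relation.Binary.Core using (Rel)
open import Relation.Binary.Morphism.Structures using (IsOrderIsomorphism)
open import Relation.Binary.PropositionalEquality.Core using (_≡_)
open import Relation.Binary.Structures using (IsStrictTotalOrder)
open import Relation.Nullary.Negation.Core using (¬_)
open import Relation.Unary using (Pred; _∈_; _≐_; _∩_; _∖_; ∁)

-- Codes of n-ary partial recursive (μ-recursive) functions.

data Rec : ℕ → Set where
  zeroᶜ   : Rec 0
  sucᶜ    : Rec 1
  proj    : ∀ {n} → Fin n → Rec n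
  comp    : ∀ {m n} → Rec m → Vec (Rec n) m → Rec n
  primrec : ∀ {n} → Rec n → Rec (suc (suc n)) → Rec (suc n)
  μ       : ∀ {n} → Rec (suc n) → Rec n

-- f [ xs ]⇓ y : the function coded by f converges on xs, with value y.

infix 4 _[_]⇓_

data _[_]⇓_ : ∀ {n} → Rec n → Vec ℕ n → ℕ → Set where
  ⇓-zero : zeroᶜ [ [] ]⇓ 0
  ⇓-suc  : ∀ {x} → sucᶜ [ x ∷ [] ]⇓ suc x
  ⇓-proj : ∀ {n} {i : Fin n} {xs} → proj i [ xs ]⇓ lookup xs i
  ⇓-comp : ∀ {m n} {f : Rec m} {gs : Vec (Rec n) m} {xs ys z} →
           Pointwise (λ g y → g [ xs ]⇓ y) gs ys →
           f [ ys ]⇓ z →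
           comp f gs [ xs ]⇓ z
  ⇓-primrec-zero : ∀ {n} {f : Rec n} {g xs y} →
                   f [ xs ]⇓ y →
                   primrec f g [ zero ∷ xs ]⇓ y
  ⇓-primrec-suc  : ∀ {n} {f : Rec n} {g xs k y z} →
                   primrec f g [ k ∷ xs ]⇓ y →
                   g [ k ∷ y ∷ xs ]⇓ z →
                   primrec f g [ suc k ∷ xs ]⇓ z
  ⇓-μ : ∀ {n} {f : Rec (suc n)} {xs y} →
        f [ y ∷ xs ]⇓ 0 →
        (∀ {i} → i < y → ∃ λ k → f [ i ∷ xs ]⇓ suc k) →
        μ f [ xs ]⇓ y

dom : Rec 1 → Pred ℕ 0ℓ
dom φ x = ∃ λ y → φ [ x ∷ [] ]⇓ y

CE : Pred ℕ 0ℓ → Set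
CE W = ∃ λ (φ : Rec 1) → W ≐ dom φ

ComputableSet : Pred ℕ 0ℓ → Set
ComputableSet A = ∃ λ (χ : Rec 1) → ∀ x →
  (A x → χ [ x ∷ [] ]⇓ 1) × (¬ A x → χ [ x ∷ [] ]⇓ 0)

ComputableRel : Rel ℕ 0ℓ → Set
ComputableRel R = ∃ λ (χ : Rec 2) → ∀ x y →
  (R x y → χ [ x ∷ y ∷ [] ]⇓ 1) × (¬ R x y → χ [ x ∷ y ∷ [] ]⇓ 0)

-- Finite and Infinite are the library's notions for subsets of ℕ:
-- bounded, respectively not bounded.

infix 4 _⊆*_

_⊆*_ : Rel (Pred ℕ 0ℓ) 0ℓ
X ⊆* Y = Finite (X ∖ Y)

Cohesive : Pred ℕ 0ℓ → Set₁
Cohesive C = Infinite C ×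
  (∀ (W : Pred ℕ 0ℓ) → CE W → Finite (W ∩ C) ⊎ Finite (∁ W ∩ C))

infix 4 _≅_

_≅_ : Rel (RawRelation 0ℓ 0ℓ 0ℓ) 0ℓ
A ≅ B = ∃ λ (f : A.Carrier → B.Carrier) →
  IsOrderIsomorphism A._≈_ B._≈_ A._∼_ B._∼_ f
  where
  module A = RawRelation A
  module B = RawRelation B

record ComputableLinearOrder : Set₁ where
  infix 4 _≺_
  field
    Dom                : Pred ℕ 0ℓ
    _≺_                : Rel ℕ 0ℓ
    ≺⊆Dom×Dom          : ∀ {x y} → x ≺ y → x ∈ Dom × y ∈ Dom
    isStrictTotalOrder : IsStrictTotalOrder {A = Σ ℕ Dom} (_≡_ on proj₁) (_≺_ on proj₁)
    computableDom      : ComputableSet Dom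
    computable≺        : ComputableRel _≺_

  order : RawRelation 0ℓ 0ℓ 0ℓ
  order = record
    { Carrier = Σ ℕ Dom
    ; _≈_     = _≡_ on proj₁
    ; _∼_     = _≺_ on proj₁
    }

  -- x and y lie in Dom by ≺⊆Dom×Dom.
  IsSuccessor : Rel ℕ 0ℓ
  IsSuccessor x y = x ≺ y × ¬ (∃ λ z → x ≺ z × z ≺ y)

  -- Nothing is asked of s outside Dom; as Dom is computable, this is the same
  -- as asking for a partial computable function with domain exactly Dom.
  ComputableSuccessor : Set
  ComputableSuccessor = ∃ λ (s : Rec 1) → ∀ {x y} → IsSuccessor x y → s [ x ∷ [] ]⇓ y

module CohesivePower (C : Pred ℕ 0ℓ) (L : ComputableLinearOrder) where
  open ComputableLinearOrder L

  -- Partial computable functions are given by codes; codes of the same function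
  -- are identified by _=C_.
  record D : Set where
    field
      code   : Rec 1
      into   : ∀ {x y} → code [ x ∷ [] ]⇓ y → y ∈ Dom
      domain : C ⊆* dom code

  open D

  _=C_ : Rel D 0ℓ
  φ =C ψ = C ⊆* (λ x → ∃ λ y → code φ [ x ∷ [] ]⇓ y × code ψ [ x ∷ [] ]⇓ y)

  _<C_ : Rel D 0ℓ
  φ <C ψ = C ⊆* (λ x → ∃₂ λ y z →
    code φ [ x ∷ [] ]⇓ y × code ψ [ x ∷ [] ]⇓ z × y ≺ z)

  power : RawRelation 0ℓ 0ℓ 0ℓ
  power = record { Carrier = D ; _≈_ = _=C_ ; _∼_ = _<C_ }

Π : Pred ℕ 0ℓ → ComputableLinearOrder → RawRelation 0ℓ 0ℓ 0ℓ
Π C L = CohesivePower.power C L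

ℕ-order : RawRelation 0ℓ 0ℓ 0ℓ
ℕ-order = StrictTotalOrder.rawRelation ℕ.<-strictTotalOrder

-- ⊎-<-strictTotalOrder does not use its level parameters d, e and f.
ℕ+ℚ×ℤ-order : RawRelation 0ℓ 0ℓ 0ℓ
ℕ+ℚ×ℤ-order = StrictTotalOrder.rawRelation
  (⊎-<-strictTotalOrder {d = 0ℓ} {0ℓ} {0ℓ} ℕ.<-strictTotalOrder
    (×-strictTotalOrder ℚ.<-strictTotalOrder ℤ.<-strictTotalOrder))

{-# OPTIONS --safe #-}
module Submission where

-- Let A be a c.e. non-computable set, here the self-halting programs of a universal machine.  The
-- order consists of the points (a , 0) for all a and (a , 1 + t) for a entering A at stage t, compared
-- lexicographically: each a contributes a bottom point and, exactly if a ∈ A, a top point.  The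
-- successor of (a , 0) decides whether a ∈ A, although the order itself is computable.
--
-- In a cohesive power, a function a(x) is either almost everywhere in A along C or almost
-- everywhere outside.  In the first case the top points over a(x) are found by search, in the
-- second there are none, so immediate successors and predecessors exist anyway.  Bottom points
-- over midpoints show that the blocks of points at finite distance are densely ordered without
-- endpoints (above the initial block), so by Cantor's theorem the nonstandard ones are indexed
-- by ℚ.

open import Defs
open import Axiom.ExcludedMiddle using (ExcludedMiddle)
open import Data.Empty using (⊥; ⊥-elim)
open import Data.Fin.Base using (Fin; zero; suc)
open import Data.Integer.Base as ℤ using (ℤ; +_; -[1+_]; ∣_∣; _⊖_; -<-; -<+; +<+)
import Data.Integer.Properties as ℤ
open import Data.List.Base using (List; []; _∷_)
import Data.List.Membership.Propositional as List
open import Data.List.Relation.Unary.Any using (here; there)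
open import Data.Nat.Base
open import Data.Nat.Properties
open import Data.Nat.Solver using (module +-*-Solver)
open import Data.Product.Base using (∃; _×_; _,_; proj₁; proj₂)
open import Data.Product.Relation.Binary.Lex.Strict using (×-strictTotalOrder)
open import Data.Rational.Base as ℚ using (ℚ; mkℚ; 0ℚ; 1ℚ)
import Data.Rational.Properties as ℚ
open import Data.Sum.Base using (_⊎_; inj₁; inj₂; [_,_]′; swap)
open import Data.Sum.Relation.Binary.LeftOrder using (⊎-<-strictTotalOrder; ₁∼₁; ₁∼₂; ₂∼₂)
open import Data.Sum.Relation.Binary.Pointwise using (inj₁; inj₂)
open import Data.Vec.Base using (Vec; []; _∷_; lookup)
open import Data.Vec.Relation.Binary.Pointwise.Inductive using (Pointwise; []; _∷_)
open import Function.Base using (id; _∘_; flip)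
open import Level using (0ℓ)
open import Relation.Binary.Bundles using (StrictTotalOrder)
open import Relation.Binary.Definitions using (Tri; tri<; tri≈; tri>)
open import Relation.Binary.Morphism.Structures using (IsOrderIsomorphism)
open import Relation.Binary.PropositionalEquality
open import Relation.Nullary.Decidable.Core using (yes; no; decidable-stable)
open import Relation.Nullary.Negation.Core using (¬_; contradiction)
open import Relation.Unary using (Pred)

-- Computable functions

-- Recording the halting time in a top point makes the order computable: whether (a , 1 + t) is a
-- point is settled by running t steps, and points are compared by fibre index and by the presence
-- of a second coordinate. Halting times are unique, so a fibre has at most two points and the order
-- type is ω. The position of a point, `rank`, counts members of A and is defined by excluded
-- middle. Constructions in the power are therefore made with fibre indices and transferred to
-- ranks, since k consecutive fibres hold between k and 2k points. Evaluation is an inductive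
-- relation without step counts; hence the machine. It supplies the c.e. set and its undecidability,
-- the determinism of evaluation and, as compiled programs are numbers, the countability that
-- Cantor's theorem requires. Seen through ranks, the power is a family of functions to ℕ compared
-- almost everywhere on C. Its order type follows from the properties collected in `EventualOrder`,
-- which no longer mention computability.

private variable
  n : ℕ

Computable : (Vec ℕ n → ℕ) → Set
Computable {n} f = ∃ λ (c : Rec n) → ∀ xs → c [ xs ]⇓ f xs

-- Records rather than abbreviations, so that f can be inferred from the type.
record Computable₁ (f : ℕ → ℕ) : Set where
  constructor unary
  field computable : Computable {1} λ xs → f (lookup xs zero)

record Computable₂ (f : ℕ → ℕ → ℕ) : Set where
  constructor binary
  field computable : Computable {2} λ xs → f (lookup xs zero) (lookup xs (suc zero))

record Computable₃ (f : ℕ → ℕ → ℕ → ℕ) : Set where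
  constructor ternary
  field computable : Computable {3} λ xs →
          f (lookup xs zero) (lookup xs (suc zero)) (lookup xs (suc (suc zero)))

var : (i : Fin n) → Computable λ xs → lookup xs i
var i = proj i , λ xs → ⇓-proj

app₁ : ∀ {f} {g : Vec ℕ n → ℕ} →
       Computable₁ f → Computable g → Computable λ xs → f (g xs)
app₁ (unary (c , p)) (d , q) = comp c (d ∷ []) , λ xs → ⇓-comp (q xs ∷ []) (p _)

app₂ : ∀ {f} {g h : Vec ℕ n → ℕ} →
       Computable₂ f → Computable g → Computable h → Computable λ xs → f (g xs) (h xs)
app₂ (binary (c , p)) (d , q) (e , r) =
  comp c (d ∷ e ∷ []) , λ xs → ⇓-comp (q xs ∷ r xs ∷ []) (p _)

app₃ : ∀ {f} {g h k : Vec ℕ n → ℕ} →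
       Computable₃ f → Computable g → Computable h → Computable k →
       Computable λ xs → f (g xs) (h xs) (k xs)
app₃ (ternary (c , p)) (d , q) (e , r) (i , s) =
  comp c (d ∷ e ∷ i ∷ []) , λ xs → ⇓-comp (q xs ∷ r xs ∷ s xs ∷ []) (p _)

-- The recursion equations are hypotheses about an ordinary function F, so for functions defined by
-- matching on their first argument they are mostly `refl`.
computable-primrec : ∀ {f : Vec ℕ n → ℕ} {g} {F : Vec ℕ (suc n) → ℕ} →
                     (∀ xs → F (0 ∷ xs) ≡ f xs) →
                     (∀ k xs → F (suc k ∷ xs) ≡ g (k ∷ F (k ∷ xs) ∷ xs)) →
                     Computable f → Computable g → Computable F
computable-primrec {f = f} {g} {F} eq₀ eq₊ (c , p) (d , q) =
  primrec c d , λ where (k ∷ xs) → go k xs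
  where
  go : ∀ k xs → primrec c d [ k ∷ xs ]⇓ F (k ∷ xs)
  go zero    xs rewrite eq₀ xs   = ⇓-primrec-zero (p xs)
  go (suc k) xs rewrite eq₊ k xs = ⇓-primrec-suc (go k xs) (q _)

suc-computable : Computable₁ suc
suc-computable = unary (sucᶜ , λ where (x ∷ []) → ⇓-suc)

const-computable : ∀ k → Computable {n} λ _ → k
const-computable zero    = comp zeroᶜ [] , λ xs → ⇓-comp [] ⇓-zero
const-computable (suc k) = app₁ suc-computable (const-computable k)

pattern #0 = zero
pattern #1 = suc zero
pattern #2 = suc (suc zero)

pred-computable : Computable₁ pred
pred-computable = unary (
  computable-primrec (λ _ → refl) (λ _ _ → refl) (const-computable 0) (var #0))

+-computable : Computable₂ _+_
+-computable = binary (computable-primrec (λ _ → refl) (λ _ _ → refl)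
  (var #0) (app₁ suc-computable (var #1)))

*-computable : Computable₂ _*_
*-computable = binary (computable-primrec (λ _ → refl) (λ _ _ → refl)
  (const-computable 0) (app₂ +-computable (var #2) (var #1)))

∸-computable : Computable₂ _∸_
-- Recursion runs on the first argument, so the subtrahend comes first and the arguments are
-- exchanged afterwards.
∸-computable = binary (app₂ {f = λ y x → x ∸ y}
  (binary (computable-primrec (λ _ → refl) (λ k xs → sym (pred[m∸n]≡m∸[1+n] (lookup xs #0) k))
    (var #0) (app₁ pred-computable (var #1))))
  (var #1) (var #0))

ifz : ℕ → ℕ → ℕ → ℕ
ifz zero    a b = a
ifz (suc _) a b = b

ifz-computable : Computable₃ ifz
ifz-computable = ternary (computable-primrec (λ _ → refl) (λ _ _ → refl)
  (var #0) (var (suc (suc (suc zero)))))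

sg : ℕ → ℕ
sg k = ifz k 0 1

sg-computable : Computable₁ sg
sg-computable = unary (app₃ ifz-computable (var #0) (const-computable 0) (const-computable 1))

-- The floor of k/2, written as a primitive recursion: the floors of k/2 and (k+1)/2 add up to k.
half : ℕ → ℕ
half zero    = 0
half (suc k) = k ∸ half k

half-computable : Computable₁ half
half-computable = unary (computable-primrec (λ _ → refl) (λ _ _ → refl)
  (const-computable 0) (app₂ ∸-computable (var #0) (var #1)))

-- The integer square root, raised by one as soon as the next square is reached.
root : ℕ → ℕ
root zero    = 0
root (suc k) = ifz (suc (root k) * suc (root k) ∸ suc k) (suc (root k)) (root k)

root-computable : Computable₁ root
root-computable = unary (computable-primrec (λ _ → refl) (λ _ _ → refl)
  (const-computable 0)
  (app₃ ifz-computable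
    (app₂ ∸-computable
      (app₂ *-computable (app₁ suc-computable (var #1)) (app₁ suc-computable (var #1)))
      (app₁ suc-computable (var #0)))
    (app₁ suc-computable (var #1)) (var #1)))

root-lower : ∀ k → root k * root k ≤ k
root-lower zero    = z≤n
root-lower (suc k) with suc (root k) * suc (root k) ∸ suc k in eq
... | zero  = m∸n≡0⇒m≤n eq
... | suc _ = m≤n⇒m≤1+n (root-lower k)

root-upper : ∀ k → k < suc (root k) * suc (root k)
root-upper zero    = s≤s z≤n
root-upper (suc k) with suc (root k) * suc (root k) ∸ suc k in eq
... | zero  = begin-strict
  suc k                                      ≤⟨ root-upper k ⟩
  suc (root k) * suc (root k)                <⟨ *-mono-< (n<1+n (suc (root k))) (n<1+n (suc (root k))) ⟩
  suc (suc (root k)) * suc (suc (root k))    ∎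
  where open ≤-Reasoning
... | suc _ = m∸n≢0⇒n<m λ eq₀ → contradiction (trans (sym eq₀) eq) λ ()

sqrt-mono : ∀ {q r k} → q * q ≤ k → k < suc r * suc r → q ≤ r
sqrt-mono {q} {r} q²≤k k<r² with <-cmp q (suc r)
... | tri< q<1+r _ _  = s≤s⁻¹ q<1+r
... | tri≈ _ refl _   = contradiction (≤-<-trans q²≤k k<r²) (n≮n _)
... | tri> _ _ 1+r<q  =
  contradiction (<-≤-trans k<r² (≤-trans (*-mono-≤ (<⇒≤ 1+r<q) (<⇒≤ 1+r<q)) q²≤k)) (n≮n _)

root-unique : ∀ {r k} → r * r ≤ k → k < suc r * suc r → root k ≡ r
root-unique {r} {k} r²≤k k<[1+r]² =
  ≤-antisym (sqrt-mono (root-lower k) k<[1+r]²) (sqrt-mono r²≤k (root-upper k))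

-- A remainder of at most w does not reach the next square, so the root of w² + a is w.
square+≤ : ∀ w a → a ≤ w → w * w + a < suc w * suc w
square+≤ w a a≤w = begin-strict
  w * w + a       ≤⟨ +-monoʳ-≤ (w * w) a≤w ⟩
  w * w + w       ≡⟨ +-comm (w * w) w ⟩
  w + w * w       ≡⟨ *-suc w w ⟨
  w * suc w       <⟨ *-monoˡ-< (suc w) (n<1+n w) ⟩
  suc w * suc w   ∎
  where open ≤-Reasoning

opaque
  -- The root of a code is a + b and the remainder is a, which yields both projections. Not every
  -- number is a code.
  pair : ℕ → ℕ → ℕ
  pair a b = (a + b) * (a + b) + a

  π₁ : ℕ → ℕ
  π₁ k = k ∸ root k * root k

  π₂ : ℕ → ℕ
  π₂ k = root k ∸ π₁ k

  pair-computable : Computable₂ pair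
  pair-computable = binary (app₂ +-computable
    (app₂ *-computable (app₂ +-computable (var #0) (var #1)) (app₂ +-computable (var #0) (var #1)))
    (var #0))

  π₁-computable : Computable₁ π₁
  π₁-computable = unary (app₂ ∸-computable (var #0)
    (app₂ *-computable (app₁ root-computable (var #0)) (app₁ root-computable (var #0))))

  π₂-computable : Computable₁ π₂
  π₂-computable = unary (app₂ ∸-computable (app₁ root-computable (var #0)) (app₁ π₁-computable (var #0)))

  root-pair : ∀ a b → root (pair a b) ≡ a + b
  root-pair a b = root-unique (m≤m+n _ a) (square+≤ (a + b) a (m≤m+n a b))

  π₁-pair : ∀ a b → π₁ (pair a b) ≡ a
  π₁-pair a b rewrite root-pair a b = m+n∸m≡n ((a + b) * (a + b)) a

  π₂-pair : ∀ a b → π₂ (pair a b) ≡ b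
  π₂-pair a b rewrite π₁-pair a b | root-pair a b = m+n∸m≡n a b

  pair-0-0 : pair 0 0 ≡ 0
  pair-0-0 = refl

-- A universal machine

-- The successor keeps 0 free for the empty stack.
push : ℕ → ℕ → ℕ
push c k = suc (pair c k)

-- The state reached after halting; it is not of the form pair 0 v, so that a computation
-- halts at exactly one time.
dead : ℕ
dead = pair (push (pair 10 0) 0) 0

-- A state pairs a stack of instructions with a current value v; an instruction pairs a tag with an
-- argument a, and k is the rest of the stack. Tags 0 to 4 are zero, identity, successor and the
-- projections; 5 is composition, 6 pairs two results, 9 iterates. Tags 7 and 8 are frames left by
-- 6: one keeps the second program and the input, the other the first result. The test `tag ∸ m`
-- detects tag m because smaller tags are already handled.
exec : ℕ → ℕ → ℕ → ℕ → ℕ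
exec tag a k v =
  ifz tag       (pair k 0) (
  ifz (tag ∸ 1) (pair k v) (
  ifz (tag ∸ 2) (pair k (suc v)) (
  ifz (tag ∸ 3) (pair k (π₁ v)) (
  ifz (tag ∸ 4) (pair k (π₂ v)) (
  ifz (tag ∸ 5) (pair (push (π₂ a) (push (π₁ a) k)) v) (
  ifz (tag ∸ 6) (pair (push (π₁ a) (push (pair 7 (pair (π₂ a) v)) k)) v) (
  ifz (tag ∸ 7) (pair (push (π₁ a) (push (pair 8 v) k)) (π₂ a)) (
  ifz (tag ∸ 8) (pair k (pair a v)) (
  ifz (tag ∸ 9) (ifz (π₁ v) (pair k (π₂ v))
                            (pair (push a (push (pair 9 a) k)) (pair (pred (π₁ v)) (π₂ v))))
                dead)))))))))

step : ℕ → ℕ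
step s = ifz (π₁ s) dead
  (exec (π₁ (π₁ (pred (π₁ s)))) (π₂ (π₁ (pred (π₁ s)))) (π₂ (pred (π₁ s))) (π₂ s))

run : ℕ → ℕ → ℕ
run zero    s = s
run (suc t) s = step (run t s)

push-computable : Computable₂ push
push-computable = binary (app₁ suc-computable (app₂ pair-computable (var #0) (var #1)))

module _ {tag a k v : Vec ℕ n → ℕ} (τ : Computable tag) (α : Computable a)
         (κ : Computable k) (ν : Computable v) where
  private
    lit : ∀ m → Computable {n} λ _ → m
    lit = const-computable

    case : ∀ m {f g : Vec ℕ n → ℕ} → Computable f → Computable g →
           Computable λ xs → ifz (tag xs ∸ m) (f xs) (g xs)
    case m = app₃ ifz-computable (app₂ ∸-computable τ (lit m))

    _,,_ : ∀ {f g : Vec ℕ n → ℕ} → Computable f → Computable g →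
           Computable λ xs → pair (f xs) (g xs)
    _,,_ = app₂ pair-computable

    _∷∷_ : ∀ {f g : Vec ℕ n → ℕ} → Computable f → Computable g →
           Computable λ xs → push (f xs) (g xs)
    _∷∷_ = app₂ push-computable

    p₁ : ∀ {f : Vec ℕ n → ℕ} → Computable f → Computable λ xs → π₁ (f xs)
    p₁ = app₁ π₁-computable

    p₂ : ∀ {f : Vec ℕ n → ℕ} → Computable f → Computable λ xs → π₂ (f xs)
    p₂ = app₁ π₂-computable

  exec-computable : Computable λ xs → exec (tag xs) (a xs) (k xs) (v xs)
  exec-computable =
    case 0 (κ ,, lit 0) (
    case 1 (κ ,, ν) (
    case 2 (κ ,, app₁ suc-computable ν) (
    case 3 (κ ,, p₁ ν) (
    case 4 (κ ,, p₂ ν) (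
    case 5 ((p₂ α ∷∷ (p₁ α ∷∷ κ)) ,, ν) (
    case 6 ((p₁ α ∷∷ ((lit 7 ,, (p₂ α ,, ν)) ∷∷ κ)) ,, ν) (
    case 7 ((p₁ α ∷∷ ((lit 8 ,, ν) ∷∷ κ)) ,, p₂ α) (
    case 8 (κ ,, (α ,, ν)) (
    case 9 (app₃ ifz-computable (p₁ ν) (κ ,, p₂ ν)
             ((α ∷∷ ((lit 9 ,, α) ∷∷ κ)) ,, (app₁ pred-computable (p₁ ν) ,, p₂ ν)))
           (lit dead))))))))))

step-computable : Computable₁ step
step-computable = unary (app₃ ifz-computable stack (const-computable dead)
  (exec-computable (app₁ π₁-computable top) (app₁ π₂-computable top)
    (app₁ π₂-computable (app₁ pred-computable stack)) (app₁ π₂-computable (var #0))))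
  where
  stack = app₁ π₁-computable (var #0)
  top = app₁ π₁-computable (app₁ pred-computable stack)

run-computable : Computable₂ run
run-computable = binary (computable-primrec (λ _ → refl) (λ _ _ → refl)
  (var #0) (app₁ step-computable (var #1)))

step-push : ∀ tag a k v → step (pair (push (pair tag a) k) v) ≡ exec tag a k v
step-push tag a k v
  rewrite π₁-pair (push (pair tag a) k) v
        | π₂-pair (push (pair tag a) k) v
        | π₁-pair (pair tag a) k
        | π₂-pair (pair tag a) k
        | π₁-pair tag a
        | π₂-pair tag a
  = refl

step-halted : ∀ v → step (pair 0 v) ≡ dead
step-halted v rewrite π₁-pair 0 v = refl

dead-not-halted : ∀ {v} → dead ≢ pair 0 v
dead-not-halted {v} eq
  with () ← trans (sym (π₁-pair (push (pair 10 0) 0) 0)) (trans (cong π₁ eq) (π₁-pair 0 v))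

run-+ : ∀ m n s → run (m + n) s ≡ run m (run n s)
run-+ zero    n s = refl
run-+ (suc m) n s = cong step (run-+ m n s)

-- The instruction in `dead` has tag 10, which fails all tests of `exec` and falls through to `dead`
-- again.
run-dead : ∀ t → run t dead ≡ dead
run-dead zero    = refl
run-dead (suc t) = trans (cong step (run-dead t)) (step-push 10 0 0 0)

halted-once : ∀ {s t t′ v v′} → run t s ≡ pair 0 v → run t′ s ≡ pair 0 v′ → ¬ (t < t′)
halted-once {s} {t} {t′} {v} eq eq′ t<t′ = dead-not-halted (begin
  dead                        ≡⟨ run-dead d ⟨
  run d dead                  ≡⟨ cong (run d) (step-halted v) ⟨
  run d (step (pair 0 v))     ≡⟨ cong (λ z → run d (step z)) eq ⟨
  run d (run (suc t) s)       ≡⟨ run-+ d (suc t) s ⟨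
  run (d + suc t) s           ≡⟨ cong (λ z → run z s) (m∸n+n≡m t<t′) ⟩
  run t′ s                    ≡⟨ eq′ ⟩
  pair 0 _                    ∎)
  where
  open ≡-Reasoning
  d : ℕ
  d = t′ ∸ suc t

-- This uniqueness leaves each fibre at most one top point, and makes any halting time found by μ
-- the least one.
halting-time-unique : ∀ {s t t′ v v′} → run t s ≡ pair 0 v → run t′ s ≡ pair 0 v′ → t ≡ t′
halting-time-unique {t = t} {t′ = t′} eq eq′ with <-cmp t t′
... | tri< t<t′ _ _ = contradiction t<t′ (halted-once eq eq′)
... | tri≈ _ t≡t′ _ = t≡t′
... | tri> _ _ t>t′ = contradiction t>t′ (halted-once eq′ eq)

-- Programs of the machine and the compiler

infix 4 _↠_ _⊢_⇒_

_↠_ : ℕ → ℕ → Set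
s ↠ s′ = ∃ λ t → run t s ≡ s′

↠-trans : ∀ {a b c} → a ↠ b → b ↠ c → a ↠ c
↠-trans {a} (m , refl) (n , refl) = n + m , run-+ n m a

halted-unique : ∀ {s v v′} → s ↠ pair 0 v → s ↠ pair 0 v′ → v ≡ v′
halted-unique {v = v} {v′} (t , eq) (t′ , eq′)
  with refl ← halting-time-unique {t = t} {t′} eq eq′ =
  trans (sym (π₂-pair 0 v)) (trans (cong π₂ (trans (sym eq) eq′)) (π₂-pair 0 v′))

-- The quantifier over the remaining stack k lets runs be chained.
_⊢_⇒_ : ℕ → ℕ → ℕ → Set
c ⊢ v ⇒ w = ∀ k → pair (push c k) v ↠ pair k w

zeroᴵ idᴵ sucᴵ fstᴵ sndᴵ : ℕ
zeroᴵ = pair 0 0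
idᴵ   = pair 1 0
sucᴵ  = pair 2 0
fstᴵ  = pair 3 0
sndᴵ  = pair 4 0

infixr 9 _∘ᴵ_

_∘ᴵ_ forkᴵ : ℕ → ℕ → ℕ
c ∘ᴵ d    = pair 5 (pair c d)
forkᴵ c d = pair 6 (pair c d)

-- The body receives the decremented counter and returns a whole new state, counter included. One
-- instruction thus covers both the bounded iteration of primitive recursion and the unbounded
-- search of μ.
loopᴵ : ℕ → ℕ
loopᴵ c = pair 9 c

⇒-zero : ∀ {v} → zeroᴵ ⊢ v ⇒ 0
⇒-zero k = 1 , step-push 0 0 k _

⇒-id : ∀ {v} → idᴵ ⊢ v ⇒ v
⇒-id k = 1 , step-push 1 0 k _

⇒-suc : ∀ {v} → sucᴵ ⊢ v ⇒ suc v
⇒-suc k = 1 , step-push 2 0 k _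

⇒-fst : ∀ {a b} → fstᴵ ⊢ pair a b ⇒ a
⇒-fst {a} {b} k = 1 , trans (step-push 3 0 k _) (cong (pair k) (π₁-pair a b))

⇒-snd : ∀ {a b} → sndᴵ ⊢ pair a b ⇒ b
⇒-snd {a} {b} k = 1 , trans (step-push 4 0 k _) (cong (pair k) (π₂-pair a b))

⇒-∘ : ∀ {c d u v w} → d ⊢ u ⇒ v → c ⊢ v ⇒ w → c ∘ᴵ d ⊢ u ⇒ w
⇒-∘ {c} {d} {u} p q k = ↠-trans (1 , eq) (↠-trans (p _) (q k))
  where
  eq : step (pair (push (c ∘ᴵ d) k) u) ≡ pair (push d (push c k)) u
  eq rewrite step-push 5 (pair c d) k u | π₁-pair c d | π₂-pair c d = refl

⇒-fork : ∀ {c d u v w} → c ⊢ u ⇒ v → d ⊢ u ⇒ w → forkᴵ c d ⊢ u ⇒ pair v w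
⇒-fork {c} {d} {u} {v} {w} p q k =
  ↠-trans (1 , eq₁) (↠-trans (p _) (↠-trans (1 , eq₂) (↠-trans (q _) (1 , step-push 8 v k w))))
  where
  eq₁ : step (pair (push (forkᴵ c d) k) u) ≡ pair (push c (push (pair 7 (pair d u)) k)) u
  eq₁ rewrite step-push 6 (pair c d) k u | π₁-pair c d | π₂-pair c d = refl

  eq₂ : step (pair (push (pair 7 (pair d u)) k) v) ≡ pair (push d (push (pair 8 v) k)) u
  eq₂ rewrite step-push 7 (pair d u) k v | π₁-pair d u | π₂-pair d u = refl

⇒-loop-done : ∀ {c v} → loopᴵ c ⊢ pair 0 v ⇒ v
⇒-loop-done {c} {v} k = 1 , eq
  where
  eq : step (pair (push (loopᴵ c) k) (pair 0 v)) ≡ pair k v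
  eq rewrite step-push 9 c k (pair 0 v) | π₁-pair 0 v | π₂-pair 0 v = refl

⇒-loop-step : ∀ {c t u v w} → c ⊢ pair t u ⇒ v → loopᴵ c ⊢ v ⇒ w → loopᴵ c ⊢ pair (suc t) u ⇒ w
⇒-loop-step {c} {t} {u} p q k = ↠-trans (1 , eq) (↠-trans (p _) (q k))
  where
  eq : step (pair (push (loopᴵ c) k) (pair (suc t) u)) ≡ pair (push c (push (loopᴵ c) k)) (pair t u)
  eq rewrite step-push 9 c k (pair (suc t) u) | π₁-pair (suc t) u | π₂-pair (suc t) u = refl

encode : Vec ℕ n → ℕ
encode []       = 0
encode (x ∷ xs) = pair x (encode xs)

-- Acts on loop states pair t (pair i (pair y xs)): t steps remain, and y is the value at i.
primrec-body : ℕ → ℕ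
primrec-body g = forkᴵ fstᴵ (forkᴵ (sucᴵ ∘ᴵ fstᴵ ∘ᴵ sndᴵ)
  (forkᴵ (g ∘ᴵ sndᴵ) (sndᴵ ∘ᴵ sndᴵ ∘ᴵ sndᴵ)))

primrec-start : ℕ → ℕ
primrec-start f = forkᴵ fstᴵ (forkᴵ zeroᴵ (forkᴵ (f ∘ᴵ sndᴵ) sndᴵ))

-- The value of f serves as loop counter: a zero ends the loop, and otherwise the body discards what
-- is left of it and moves on to the next candidate.
μ-test : ℕ → ℕ
μ-test f = forkᴵ f idᴵ

μ-body : ℕ → ℕ
μ-body f = μ-test f ∘ᴵ forkᴵ (sucᴵ ∘ᴵ fstᴵ ∘ᴵ sndᴵ) (sndᴵ ∘ᴵ sndᴵ)

projᴵ : Fin n → ℕ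
projᴵ zero    = fstᴵ
projᴵ (suc i) = projᴵ i ∘ᴵ sndᴵ

compile : Rec n → ℕ
compiles : ∀ {m} → Vec (Rec n) m → ℕ

compile zeroᶜ         = zeroᴵ
compile sucᶜ          = sucᴵ ∘ᴵ fstᴵ
compile (proj i)      = projᴵ i
compile (comp f gs)   = compile f ∘ᴵ compiles gs
compile (primrec f g) =
  fstᴵ ∘ᴵ sndᴵ ∘ᴵ loopᴵ (primrec-body (compile g)) ∘ᴵ primrec-start (compile f)
compile (μ f)         =
  fstᴵ ∘ᴵ loopᴵ (μ-body (compile f)) ∘ᴵ μ-test (compile f) ∘ᴵ forkᴵ zeroᴵ idᴵ

compiles []       = zeroᴵ
compiles (g ∷ gs) = forkᴵ (compile g) (compiles gs)

⇒-proj : ∀ (i : Fin n) xs → projᴵ i ⊢ encode xs ⇒ lookup xs i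
⇒-proj zero    (x ∷ xs) = ⇒-fst
⇒-proj (suc i) (x ∷ xs) = ⇒-∘ ⇒-snd (⇒-proj i xs)

⇒-primrec-body : ∀ {g t i y z p} → g ⊢ pair i (pair y p) ⇒ z →
                 primrec-body g ⊢ pair t (pair i (pair y p)) ⇒ pair t (pair (suc i) (pair z p))
⇒-primrec-body q =
  ⇒-fork ⇒-fst (⇒-fork (⇒-∘ (⇒-∘ ⇒-snd ⇒-fst) ⇒-suc)
    (⇒-fork (⇒-∘ ⇒-snd q) (⇒-∘ (⇒-∘ ⇒-snd ⇒-snd) ⇒-snd)))

-- Induction on the distance m from the candidate i to the zero y.
⇒-μ-loop : ∀ {f p y} → f ⊢ pair y p ⇒ 0 → (∀ {i} → i < y → ∃ λ k → f ⊢ pair i p ⇒ suc k) →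
           ∀ m {i} → m + i ≡ y →
           ∃ λ v → (μ-test f ⊢ pair i p ⇒ v) × (loopᴵ (μ-body f) ⊢ v ⇒ pair y p)
⇒-μ-loop found below zero    refl = _ , ⇒-fork found ⇒-id , ⇒-loop-done
⇒-μ-loop found below (suc m) {i} eq
  with k , q ← below (m+n≤o⇒n≤o m (≤-reflexive (trans (+-suc m i) eq)))
  with v , r , s ← ⇒-μ-loop found below m {suc i} (trans (+-suc m i) eq) =
  _ , ⇒-fork q ⇒-id ,
  ⇒-loop-step (⇒-∘ (⇒-fork (⇒-∘ (⇒-∘ ⇒-snd ⇒-fst) ⇒-suc) (⇒-∘ ⇒-snd ⇒-snd)) r) s

compile-correct : ∀ {f : Rec n} {xs y} → f [ xs ]⇓ y → compile f ⊢ encode xs ⇒ y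
compiles-correct : ∀ {m} {gs : Vec (Rec n) m} {xs ys} →
                   Pointwise (λ g y → g [ xs ]⇓ y) gs ys → compiles gs ⊢ encode xs ⇒ encode ys
-- A derivation ends with the last recursion step, whereas the loop starts with the first. The
-- induction on the derivation therefore leaves open the t iterations still to come and their
-- outcome w.
primrec-correct : ∀ {f : Rec n} {g xs k y} → primrec f g [ k ∷ xs ]⇓ y → ∀ t {w} →
                  loopᴵ (primrec-body (compile g)) ⊢ pair t (pair k (pair y (encode xs))) ⇒ w →
                  loopᴵ (primrec-body (compile g)) ∘ᴵ primrec-start (compile f)
                    ⊢ pair (k + t) (encode xs) ⇒ w

compile-correct ⇓-zero = ⇒-zero
compile-correct ⇓-suc = ⇒-∘ ⇒-fst ⇒-suc
compile-correct (⇓-proj {i = i} {xs}) = ⇒-proj i xs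
compile-correct (⇓-comp ds d) = ⇒-∘ (compiles-correct ds) (compile-correct d)
compile-correct d@(⇓-primrec-zero _) =
  ⇒-∘ (⇒-∘ (primrec-correct d 0 ⇒-loop-done) ⇒-snd) ⇒-fst
compile-correct {f = f} {suc k ∷ xs} {y} d@(⇓-primrec-suc _ _) =
  subst (λ z → compile f ⊢ pair (suc z) (encode xs) ⇒ y) (+-identityʳ k)
    (⇒-∘ (⇒-∘ (primrec-correct d 0 ⇒-loop-done) ⇒-snd) ⇒-fst)
compile-correct (⇓-μ {y = y} d below)
  with v , r , s ← ⇒-μ-loop (compile-correct d)
         (λ i<y → proj₁ (below i<y) , compile-correct (proj₂ (below i<y))) y (+-identityʳ y) =
  ⇒-∘ (⇒-∘ (⇒-∘ (⇒-fork ⇒-zero ⇒-id) r) s) ⇒-fst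

compiles-correct []       = ⇒-zero
compiles-correct (d ∷ ds) = ⇒-fork (compile-correct d) (compiles-correct ds)

primrec-correct (⇓-primrec-zero d) t p =
  ⇒-∘ (⇒-fork ⇒-fst (⇒-fork ⇒-zero (⇒-fork (⇒-∘ ⇒-snd (compile-correct d)) ⇒-snd))) p
primrec-correct {f = f} {g} {xs} {suc k} (⇓-primrec-suc d e) t {w} p =
  subst (λ z → loopᴵ (primrec-body (compile g)) ∘ᴵ primrec-start (compile f)
                 ⊢ pair z (encode xs) ⇒ w) (+-suc k t)
    (primrec-correct d (suc t) (⇒-loop-step (⇒-primrec-body (compile-correct e)) p))

init : ℕ → ℕ → ℕ
init c x = pair (push c 0) (pair x 0)

init-computable : Computable₂ init
init-computable = binary (app₂ pair-computable (app₂ push-computable (var #0) (const-computable 0))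
  (app₂ pair-computable (var #1) (const-computable 0)))

-- For f = g this is determinism of evaluation. For different codes it makes the compiled program an
-- index of the function, with no need for `compile` to be injective on codes.
compile-determines : ∀ {f g : Rec n} {xs y z} → compile f ≡ compile g →
                     f [ xs ]⇓ y → g [ xs ]⇓ z → y ≡ z
compile-determines {xs = xs} {y} eq d e = halted-unique
  (subst (λ c → pair (push c 0) (encode xs) ↠ pair 0 y) eq (compile-correct d 0))
  (compile-correct e 0)

⇓-deterministic : ∀ {f : Rec n} {xs y z} → f [ xs ]⇓ y → f [ xs ]⇓ z → y ≡ z
⇓-deterministic = compile-determines refl

-- The order

selfRun : ℕ → ℕ → ℕ
selfRun t a = run t (init a a)

selfRun-computable : Computable₂ selfRun
selfRun-computable = binary (app₂ run-computable (var #0) (app₂ init-computable (var #1) (var #1)))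

-- 0 is the state that has halted with output 0.
SelfHalting : Pred ℕ 0ℓ
SelfHalting a = ∃ λ t → selfRun t a ≡ 0

selfRun-unique : ∀ {t t′ a} → selfRun t a ≡ 0 → selfRun t′ a ≡ 0 → t ≡ t′
selfRun-unique {t} {t′} eq eq′ = halting-time-unique {t = t} {t′}
  (trans eq (sym pair-0-0)) (trans eq′ (sym pair-0-0))

-- Diagonalisation at the compiled χ itself: belonging to the set means answering 0 on its own
-- number, where χ should answer 1.
selfHalting-undecidable : (χ : Rec 1) →
  ¬ (∀ a → (SelfHalting a → χ [ a ∷ [] ]⇓ 1) × (¬ SelfHalting a → χ [ a ∷ [] ]⇓ 0))
selfHalting-undecidable χ decides = ¬halts (reaches⇒halts (compile-correct (proj₂ (decides e) ¬halts) 0))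
  where
  e : ℕ
  e = compile χ

  reaches⇒halts : init e e ↠ pair 0 0 → SelfHalting e
  reaches⇒halts (t , eq) = t , trans eq pair-0-0

  ¬halts : ¬ SelfHalting e
  ¬halts h@(t , eq)
    with () ← halted-unique (t , trans eq (sym pair-0-0)) (compile-correct (proj₁ (decides e) h) 0)

half-bounds : ∀ k → half k + half k ≤ k × k ≤ suc (half k + half k)
half-bounds zero    = z≤n , z≤n
half-bounds (suc k) with half k | half-bounds k
... | h | lower , upper = lower′ , upper′
  where
  open ≤-Reasoning
  h+h′ : h + (k ∸ h) ≡ k
  h+h′ = m+[n∸m]≡n (m+n≤o⇒m≤o h lower)

  lower′ : (k ∸ h) + (k ∸ h) ≤ suc k
  lower′ = begin
    (k ∸ h) + (k ∸ h)  ≤⟨ +-monoˡ-≤ (k ∸ h) (m≤n+o⇒m∸n≤o k h (≤-trans upper (≤-reflexive (sym (+-suc h h))))) ⟩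
    suc (h + (k ∸ h))  ≡⟨ cong suc h+h′ ⟩
    suc k              ∎

  upper′ : suc k ≤ suc ((k ∸ h) + (k ∸ h))
  upper′ = s≤s (begin
    k                  ≡⟨ h+h′ ⟨
    h + (k ∸ h)        ≤⟨ +-monoˡ-≤ (k ∸ h) (m+n≤o⇒m≤o∸n h lower) ⟩
    (k ∸ h) + (k ∸ h)  ∎)

-- A sum vanishes iff its terms do. The two truncated differences force m to be a code of a pair;
-- the last term asks for second coordinate 0 or for halting at exactly the recorded time.
domTest : ℕ → ℕ
domTest m =
  (m ∸ pair (π₁ m) (π₂ m)) + (pair (π₁ m) (π₂ m) ∸ m) +
  ifz (π₂ m) 0 (selfRun (pred (π₂ m)) (π₁ m))

domTest-computable : Computable₁ domTest
domTest-computable = unary (app₂ +-computable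
  (app₂ +-computable (app₂ ∸-computable (var #0) p) (app₂ ∸-computable p (var #0)))
  (app₃ ifz-computable (app₁ π₂-computable (var #0)) (const-computable 0)
    (app₂ selfRun-computable (app₁ pred-computable (app₁ π₂-computable (var #0)))
      (app₁ π₁-computable (var #0)))))
  where
  p = app₂ pair-computable (app₁ π₁-computable (var #0)) (app₁ π₂-computable (var #0))

-- Points are the codes of (a , 0), and of (a , 1 + t) if a halts at time t.
Point : Pred ℕ 0ℓ
Point m = domTest m ≡ 0

data PointView : ℕ → Set where
  bottom : ∀ a → PointView (pair a 0)
  top    : ∀ a t → selfRun t a ≡ 0 → PointView (pair a (suc t))

point-bottom : ∀ a → Point (pair a 0)
point-bottom a rewrite π₁-pair a 0 | π₂-pair a 0 | n∸n≡0 (pair a 0) = refl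

point-top : ∀ {a t} → selfRun t a ≡ 0 → Point (pair a (suc t))
point-top {a} {t} eq
  rewrite π₁-pair a (suc t) | π₂-pair a (suc t) | n∸n≡0 (pair a (suc t)) = eq

pointView : ∀ {m} → Point m → PointView m
pointView {m} p = subst PointView (sym m≡pair) (view (π₁ m) (π₂ m) (m+n≡0⇒n≡0 _ p))
  where
  differences : (m ∸ pair (π₁ m) (π₂ m)) + (pair (π₁ m) (π₂ m) ∸ m) ≡ 0
  differences = m+n≡0⇒m≡0 _ p

  m≡pair : m ≡ pair (π₁ m) (π₂ m)
  m≡pair = ≤-antisym (m∸n≡0⇒m≤n (m+n≡0⇒m≡0 _ differences))
                     (m∸n≡0⇒m≤n (m+n≡0⇒n≡0 (m ∸ pair (π₁ m) (π₂ m)) differences))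

  view : ∀ a b → ifz b 0 (selfRun (pred b) a) ≡ 0 → PointView (pair a b)
  view a zero    _  = bottom a
  view a (suc t) eq = top a t eq

-- With at most one top per fibre, only the sign of the second coordinate matters: bottoms get even
-- numbers, tops odd ones. This is computable but leaves gaps at missing tops, which `rank` closes.
key : ℕ → ℕ
key m = 2 * π₁ m + sg (π₂ m)

key-computable : Computable₁ key
key-computable = unary (app₂ +-computable
  (app₂ *-computable (const-computable 2) (app₁ π₁-computable (var #0)))
  (app₁ sg-computable (app₁ π₂-computable (var #0))))

key-bottom : ∀ a → key (pair a 0) ≡ 2 * a
key-bottom a rewrite π₁-pair a 0 | π₂-pair a 0 = +-identityʳ (2 * a)

key-top : ∀ a t → key (pair a (suc t)) ≡ suc (2 * a)
key-top a t rewrite π₁-pair a (suc t) | π₂-pair a (suc t) = +-comm (2 * a) 1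

key-injective : ∀ {x y} → Point x → Point y → key x ≡ key y → x ≡ y
key-injective p q eq with pointView p | pointView q
... | bottom a | bottom b rewrite key-bottom a | key-bottom b =
  cong (λ z → pair z 0) (*-cancelˡ-≡ a b 2 eq)
... | bottom a | top b t _ rewrite key-bottom a | key-top b t = contradiction eq (even≢odd a b)
... | top a t _ | bottom b rewrite key-bottom b | key-top a t =
  contradiction (sym eq) (even≢odd b a)
... | top a t h | top b t′ h′ rewrite key-top a t | key-top b t′
  with refl ← *-cancelˡ-≡ a b 2 (suc-injective eq)
  with refl ← selfRun-unique {t} {t′} h h′ = refl

-- Ranks and the isomorphism with ℕ

module Construction (em : ExcludedMiddle 0ℓ) where

  time : ℕ → ℕ
  time a with em {SelfHalting a}
  ... | yes (t , _) = suc t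
  ... | no _        = 0

  -- The last point over a. The default 0 of `time` makes it the bottom when a does not halt.
  topPoint : ℕ → ℕ
  topPoint a = pair a (time a)

  topPoint-point : ∀ a → Point (topPoint a)
  topPoint-point a with em {SelfHalting a}
  ... | yes (_ , eq) = point-top eq
  ... | no _         = point-bottom a

  time-halting : ∀ {t a} → selfRun t a ≡ 0 → time a ≡ suc t
  time-halting {t} {a} eq with em {SelfHalting a}
  ... | yes (t′ , eq′) = cong suc (selfRun-unique {t′} {t} eq′ eq)
  ... | no ¬h          = contradiction (t , eq) ¬h

  time-looping : ∀ {a} → ¬ SelfHalting a → time a ≡ 0
  time-looping {a} ¬h with em {SelfHalting a}
  ... | yes h = contradiction h ¬h
  ... | no _  = refl

  -- The number of points in the fibres before a.
  base : ℕ → ℕ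
  base zero    = 0
  base (suc a) = suc (base a + sg (time a))

  rank : ℕ → ℕ
  rank m = base (π₁ m) + sg (π₂ m)

  rank-bottom : ∀ a → rank (pair a 0) ≡ base a
  rank-bottom a rewrite π₁-pair a 0 | π₂-pair a 0 = +-identityʳ (base a)

  rank-top : ∀ a t → rank (pair a (suc t)) ≡ suc (base a)
  rank-top a t rewrite π₁-pair a (suc t) | π₂-pair a (suc t) = +-comm (base a) 1

  rank-topPoint : ∀ a → rank (topPoint a) ≡ base a + sg (time a)
  rank-topPoint a rewrite π₁-pair a (time a) | π₂-pair a (time a) = refl

  rank-nextBottom : ∀ a → rank (pair (suc a) 0) ≡ suc (rank (topPoint a))
  rank-nextBottom a = trans (rank-bottom (suc a)) (cong suc (sym (rank-topPoint a)))

  -- Each fibre has one or two points. This bound and `base-upper` let fibre indices replace ranks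
  -- wherever only the finiteness of a distance counts.
  base-lower : ∀ a k → base a + k ≤ base (k + a)
  base-lower a zero    = ≤-reflexive (+-identityʳ (base a))
  base-lower a (suc k) = begin
    base a + suc k     ≡⟨ +-suc (base a) k ⟩
    suc (base a + k)   ≤⟨ s≤s (base-lower a k) ⟩
    suc (base (k + a)) ≤⟨ s≤s (m≤m+n _ _) ⟩
    base (suc k + a)   ∎
    where open ≤-Reasoning

  sg≤1 : ∀ k → sg k ≤ 1
  sg≤1 zero    = z≤n
  sg≤1 (suc _) = ≤-refl

  base-suc-upper : ∀ a → base (suc a) ≤ 2 + base a
  base-suc-upper a = s≤s (≤-trans (+-monoʳ-≤ (base a) (sg≤1 (time a))) (≤-reflexive (+-comm (base a) 1)))

  base-upper : ∀ a k → base (k + a) ≤ 2 * k + base a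
  base-upper a zero    = ≤-refl
  base-upper a (suc k) = begin
    base (suc k + a)       ≤⟨ base-suc-upper (k + a) ⟩
    2 + base (k + a)       ≤⟨ +-monoʳ-≤ 2 (base-upper a k) ⟩
    2 + (2 * k + base a)   ≡⟨ cong (_+ base a) (*-suc 2 k) ⟨
    2 * suc k + base a     ∎
    where open ≤-Reasoning

  base-mono-≤ : ∀ {a b} → a ≤ b → base a ≤ base b
  base-mono-≤ {a} {b} a≤b = begin
    base a              ≤⟨ m≤m+n _ _ ⟩
    base a + (b ∸ a)    ≤⟨ base-lower a (b ∸ a) ⟩
    base (b ∸ a + a)    ≡⟨ cong base (m∸n+n≡m a≤b) ⟩
    base b              ∎
    where open ≤-Reasoning

  rank-lower : ∀ m → base (π₁ m) ≤ rank m
  rank-lower m = m≤m+n _ _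

  rank-upper : ∀ m → rank m ≤ suc (base (π₁ m))
  rank-upper m = ≤-trans (+-monoʳ-≤ _ (sg≤1 (π₂ m))) (≤-reflexive (+-comm _ 1))

  rank-≤-topPoint : ∀ {m} → Point m → rank m ≤ rank (topPoint (π₁ m))
  rank-≤-topPoint p with pointView p
  ... | bottom a = begin
    rank (pair a 0)                    ≡⟨ rank-bottom a ⟩
    base a                             ≤⟨ m≤m+n _ _ ⟩
    base a + sg (time a)               ≡⟨ rank-topPoint a ⟨
    rank (topPoint a)                  ≡⟨ cong (λ z → rank (topPoint z)) (π₁-pair a 0) ⟨
    rank (topPoint (π₁ (pair a 0)))    ∎
    where open ≤-Reasoning
  ... | top a t h = begin
    rank (pair a (suc t))                    ≡⟨ cong (λ z → rank (pair a z)) (time-halting {t} h) ⟨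
    rank (topPoint a)                        ≡⟨ cong (λ z → rank (topPoint z)) (π₁-pair a (suc t)) ⟨
    rank (topPoint (π₁ (pair a (suc t))))    ∎
    where open ≤-Reasoning

  base-mono-< : ∀ {a b} → a < b → base a + sg (time a) < base b
  -- By definition `suc (base a + sg (time a))` is `base (suc a)`, and a < b is suc a ≤ b.
  base-mono-< = base-mono-≤

  rank-mono : ∀ {x y} → Point x → Point y → key x < key y → rank x < rank y
  rank-mono p q lt with pointView p | pointView q
  ... | bottom a | bottom b rewrite key-bottom a | key-bottom b | rank-bottom a | rank-bottom b =
    ≤-<-trans (m≤m+n _ _) (base-mono-< (*-cancelˡ-< 2 a b lt))
  ... | bottom a | top b t _ rewrite key-bottom a | key-top b t | rank-bottom a | rank-top b t =
    s≤s (base-mono-≤ (*-cancelˡ-≤ 2 (s≤s⁻¹ lt)))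
  ... | top a t h | bottom b rewrite key-top a t | key-bottom b | rank-top a t | rank-bottom b =
    ≤-trans (s≤s (≤-reflexive (trans (+-comm 1 (base a))
              (cong (λ z → base a + sg z) (sym (time-halting {t} h))))))
            (base-mono-< (*-cancelˡ-< 2 a b (<-trans (n<1+n _) lt)))
  ... | top a t h | top b t′ _ rewrite key-top a t | key-top b t′ | rank-top a t | rank-top b t′ =
    s≤s (≤-<-trans (m≤m+n _ _) (base-mono-< (*-cancelˡ-< 2 a b (s≤s⁻¹ lt))))

  rank-injective : ∀ {x y} → Point x → Point y → rank x ≡ rank y → x ≡ y
  rank-injective {x} {y} p q eq with <-cmp (key x) (key y)
  ... | tri< lt _ _ = contradiction eq (<⇒≢ (rank-mono p q lt))
  ... | tri≈ _ e _  = key-injective p q e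
  ... | tri> _ _ gt = contradiction (sym eq) (<⇒≢ (rank-mono q p gt))

  rank-cancel : ∀ {x y} → Point x → Point y → rank x < rank y → key x < key y
  rank-cancel {x} {y} p q lt with <-cmp (key x) (key y)
  ... | tri< k<k′ _ _ = k<k′
  ... | tri≈ _ e _    with refl ← key-injective p q e = contradiction lt (n≮n _)
  ... | tri> _ _ gt   = contradiction (<-trans lt (rank-mono q p gt)) (n≮n _)

  -- After the point m of rank n comes the top of its fibre, if m is below it, and otherwise the
  -- bottom of the next fibre.
  rank-surjective : ∀ n → ∃ λ m → Point m × rank m ≡ n
  rank-surjective zero    = pair 0 0 , point-bottom 0 , rank-bottom 0
  rank-surjective (suc n) with rank-surjective n
  ... | m , p , refl with m≤n⇒m<n∨m≡n (rank-≤-topPoint p)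
  ...   | inj₁ lt = topPoint (π₁ m) , topPoint-point (π₁ m) , ≤-antisym
            (≤-trans (≤-reflexive (rank-topPoint (π₁ m)))
              (≤-trans (+-monoʳ-≤ (base (π₁ m)) (sg≤1 (time (π₁ m))))
                (≤-trans (≤-reflexive (+-comm _ 1)) (s≤s (rank-lower m)))))
            lt
  ...   | inj₂ eq = pair (suc (π₁ m)) 0 , point-bottom _ ,
            trans (rank-nextBottom (π₁ m)) (cong suc (sym eq))

  infix 4 _≺_

  -- Ranks make the order axioms and the order type immediate; computability comes from the
  -- equivalence with `key` on points.
  _≺_ : ℕ → ℕ → Set
  x ≺ y = Point x × Point y × rank x < rank y

  order-test : ℕ → ℕ → ℕ
  order-test x y = domTest x + domTest y + (suc (key x) ∸ key y)

  order-test-computable : Computable₂ order-test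
  order-test-computable = binary (app₂ +-computable
    (app₂ +-computable (app₁ domTest-computable (var #0)) (app₁ domTest-computable (var #1)))
    (app₂ ∸-computable (app₁ suc-computable (app₁ key-computable (var #0)))
      (app₁ key-computable (var #1))))

  ≺⇒test : ∀ {x y} → x ≺ y → order-test x y ≡ 0
  ≺⇒test (p , q , lt) rewrite p | q = m≤n⇒m∸n≡0 (rank-cancel p q lt)

  test⇒≺ : ∀ {x y} → order-test x y ≡ 0 → x ≺ y
  test⇒≺ {x} {y} eq = p , q , rank-mono p q (m∸n≡0⇒m≤n (m+n≡0⇒n≡0 (domTest x + domTest y) eq))
    where
    p : Point x
    p = m+n≡0⇒m≡0 (domTest x) (m+n≡0⇒m≡0 (domTest x + domTest y) eq)
    q : Point y
    q = m+n≡0⇒n≡0 (domTest x) (m+n≡0⇒m≡0 (domTest x + domTest y) eq)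

  1∸≡0 : ∀ {k} → k ≢ 0 → 1 ∸ k ≡ 0
  1∸≡0 {zero}  ≢0 = contradiction refl ≢0
  1∸≡0 {suc k} _  = 0∸n≡0 k

  order : ComputableLinearOrder
  order = record
    { Dom                = Point
    ; _≺_                = _≺_
    ; ≺⊆Dom×Dom          = λ (p , q , _) → p , q
    ; isStrictTotalOrder = record
      { isStrictPartialOrder = record
        { isEquivalence = record { refl = refl ; sym = sym ; trans = trans }
        ; irrefl        = λ { refl (_ , _ , lt) → n≮n _ lt }
        ; trans         = λ (p , _ , lt) (_ , q , lt′) → p , q , <-trans lt lt′
        ; <-resp-≈      = (λ { refl lt → lt }) , λ { refl lt → lt }
        }
      ; compare = λ (x , p) (y , q) → ≺-cmp p q
      }
    ; computableDom = proj₁ dom-test , λ x →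
        (λ p → subst (λ k → proj₁ dom-test [ x ∷ [] ]⇓ 1 ∸ k) p (proj₂ dom-test (x ∷ []))) ,
        (λ ¬p → subst (proj₁ dom-test [ x ∷ [] ]⇓_) (1∸≡0 ¬p) (proj₂ dom-test (x ∷ [])))
    ; computable≺ = proj₁ ≺-test , λ x y →
        (λ lt → subst (λ k → proj₁ ≺-test [ x ∷ y ∷ [] ]⇓ 1 ∸ k) (≺⇒test lt) (proj₂ ≺-test (x ∷ y ∷ []))) ,
        (λ ¬lt → subst (proj₁ ≺-test [ x ∷ y ∷ [] ]⇓_) (1∸≡0 λ eq → ¬lt (test⇒≺ eq))
                   (proj₂ ≺-test (x ∷ y ∷ [])))
    }
    where
    dom-test : Computable λ xs → 1 ∸ domTest (lookup xs #0)
    dom-test = app₂ ∸-computable (const-computable 1) (app₁ domTest-computable (var #0))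

    ≺-test : Computable λ xs → 1 ∸ order-test (lookup xs #0) (lookup xs #1)
    ≺-test = app₂ ∸-computable (const-computable 1) (app₂ order-test-computable (var #0) (var #1))

    ≺-cmp : ∀ {x y} → Point x → Point y → Tri (x ≺ y) (x ≡ y) (y ≺ x)
    ≺-cmp {x} {y} p q with <-cmp (rank x) (rank y)
    ... | tri< lt ne ngt = tri< (p , q , lt) (λ { refl → ne refl }) λ (_ , _ , gt) → ngt gt
    ... | tri≈ nlt eq ngt = tri≈ (λ (_ , _ , lt) → nlt lt) (rank-injective p q eq) λ (_ , _ , gt) → ngt gt
    ... | tri> nlt ne gt = tri> (λ (_ , _ , lt) → nlt lt) (λ { refl → ne refl }) (q , p , gt)

  order≅ℕ : ComputableLinearOrder.order order ≅ ℕ-order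
  order≅ℕ = (λ (x , _) → rank x) , record
    { isOrderMonomorphism = record
      { isOrderHomomorphism = record { cong = cong rank ; mono = λ (_ , _ , lt) → lt }
      ; injective = λ {(_ , p)} {(_ , q)} → rank-injective p q
      ; cancel    = λ {(_ , p)} {(_ , q)} lt → p , q , lt
      }
    ; surjective = λ n → let m , p , eq = rank-surjective n in
        (m , p) , λ { refl → eq }
    }

  open ComputableLinearOrder order using (IsSuccessor; ComputableSuccessor)

  rank-suc⇒successor : ∀ {x y} → Point x → Point y → rank y ≡ suc (rank x) → IsSuccessor x y
  rank-suc⇒successor p q eq =
    (p , q , ≤-reflexive (sym eq)) ,
    λ (z , (_ , _ , x<z) , (_ , _ , z<y)) → <⇒≱ x<z (s≤s⁻¹ (≤-trans z<y (≤-reflexive eq)))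

  ¬computableSuccessor : ¬ ComputableSuccessor
  ¬computableSuccessor (s , succ) = selfHalting-undecidable (proj₁ χ) λ a →
    (λ (t , h) → decide a (pair a (suc t)) (successor-halting {a} {t} h)
                   (trans (cong (λ z → 1 ∸ (z ∸ a)) (π₁-pair a (suc t))) (cong (1 ∸_) (n∸n≡0 a)))) ,
    (λ ¬h → decide a (pair (suc a) 0) (successor-looping ¬h)
              (trans (cong (λ z → 1 ∸ (z ∸ a)) (π₁-pair (suc a) 0)) (cong (1 ∸_) (m+n∸n≡m 1 a))))
    where
    bot : Computable λ xs → pair (lookup xs #0) 0
    bot = app₂ pair-computable (var #0) (const-computable 0)

    -- This is 1 if the successor stays in the fibre of a and 0 if it lies over a + 1.
    test : Computable {2} λ xs → 1 ∸ (π₁ (lookup xs #0) ∸ lookup xs #1)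
    test = app₂ ∸-computable (const-computable 1)
      (app₂ ∸-computable (app₁ π₁-computable (var #0)) (var #1))

    χ : ∃ λ (c : Rec 1) → ∀ a y → s [ pair a 0 ∷ [] ]⇓ y → c [ a ∷ [] ]⇓ 1 ∸ (π₁ y ∸ a)
    χ = comp (proj₁ test) (comp s (proj₁ bot ∷ []) ∷ proj #0 ∷ []) , λ a y d →
      ⇓-comp (⇓-comp (proj₂ bot _ ∷ []) d ∷ ⇓-proj ∷ []) (proj₂ test _)

    decide : ∀ a y {k} → IsSuccessor (pair a 0) y → 1 ∸ (π₁ y ∸ a) ≡ k → proj₁ χ [ a ∷ [] ]⇓ k
    decide a y is refl = proj₂ χ a y (succ is)

    successor-halting : ∀ {a t} → selfRun t a ≡ 0 → IsSuccessor (pair a 0) (pair a (suc t))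
    successor-halting {a} {t} h = rank-suc⇒successor (point-bottom a) (point-top h)
      (trans (rank-top a t) (cong suc (sym (rank-bottom a))))

    successor-looping : ∀ {a} → ¬ SelfHalting a → IsSuccessor (pair a 0) (pair (suc a) 0)
    successor-looping {a} ¬h = rank-suc⇒successor (point-bottom a) (point-bottom (suc a))
      (trans (rank-nextBottom a) (cong (λ t → suc (rank (pair a t))) (time-looping ¬h)))

-- Elements of the cohesive power

module PowerFacts (em : ExcludedMiddle 0ℓ) (C : Pred ℕ 0ℓ) (cohesive : Cohesive C) where
  open Construction em
  open CohesivePower C order public
  open D public

  -- `C ⊆* P` without its negations; excluded middle makes the two equivalent.
  Ev : Pred ℕ 0ℓ → Set
  Ev P = ∃ λ i → ∀ {j} → i ≤ j → C j → P j

  Ev-map : ∀ {P Q : Pred ℕ 0ℓ} → (∀ {x} → P x → Q x) → Ev P → Ev Q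
  Ev-map f (i , p) = i , λ i≤j c → f (p i≤j c)

  Ev-map₂ : ∀ {P Q R : Pred ℕ 0ℓ} → (∀ {x} → P x → Q x → R x) → Ev P → Ev Q → Ev R
  Ev-map₂ f (i , p) (j , q) = i ⊔ j , λ le c →
    f (p (≤-trans (m≤m⊔n i j) le) c) (q (≤-trans (m≤n⊔m i j) le) c)

  Ev-always : ∀ {P : Pred ℕ 0ℓ} → (∀ x → P x) → Ev P
  Ev-always p = 0 , λ _ _ → p _

  Ev-large : ∀ n → Ev (n ≤_)
  Ev-large n = n , λ n≤j _ → n≤j

  Ev-proper : ¬ Ev (λ _ → ⊥)
  Ev-proper (i , p) = proj₁ cohesive (i , λ j i≤j c → p i≤j c)

  Ev⇒⊆* : ∀ {P : Pred ℕ 0ℓ} → Ev P → C ⊆* P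
  Ev⇒⊆* (i , p) = i , λ j i≤j (c , ¬p) → ¬p (p i≤j c)

  ⊆*⇒Ev : ∀ {P : Pred ℕ 0ℓ} → C ⊆* P → Ev P
  ⊆*⇒Ev (i , p) = i , λ {j} i≤j c → decidable-stable em λ ¬p → p j i≤j (c , ¬p)

  -- h extends a partial computable function that is defined almost everywhere on C.
  record AeComputable (h : ℕ → ℕ) : Set where
    field
      program : Rec 1
      sound   : ∀ {x y} → program [ x ∷ [] ]⇓ y → y ≡ h x
      defined : Ev (dom program)

    value-at : Ev (λ x → program [ x ∷ [] ]⇓ h x)
    value-at = Ev-map (λ (y , d) → subst (program [ _ ∷ [] ]⇓_) (sound d) d) defined

  open AeComputable

  ae-id : AeComputable id
  ae-id = record { program = proj #0 ; sound = λ { ⇓-proj → refl } ; defined = Ev-always λ x → x , ⇓-proj }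

  ae-app₁ : ∀ {f h} → Computable₁ f → AeComputable h → AeComputable (λ x → f (h x))
  ae-app₁ {f} {h} (unary (c , correct)) H = record
    { program = comp c (program H ∷ [])
    ; sound   = λ { (⇓-comp (d ∷ []) e) → sound′ (sound H d) e }
    ; defined = Ev-map (λ d → _ , ⇓-comp (d ∷ []) (correct _)) (value-at H)
    }
    where
    sound′ : ∀ {x y z} → y ≡ h x → c [ y ∷ [] ]⇓ z → z ≡ f (h x)
    sound′ refl e = ⇓-deterministic e (correct _)

  ae-app₂ : ∀ {f g h} → Computable₂ f → AeComputable g → AeComputable h →
            AeComputable (λ x → f (g x) (h x))
  ae-app₂ {f} {g} {h} (binary (c , correct)) G H = record
    { program = comp c (program G ∷ program H ∷ [])
    ; sound   = λ { (⇓-comp (d ∷ d′ ∷ []) e) → sound′ (sound G d) (sound H d′) e }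
    ; defined = Ev-map₂ (λ d d′ → _ , ⇓-comp (d ∷ d′ ∷ []) (correct _)) (value-at G) (value-at H)
    }
    where
    sound′ : ∀ {x y y′ z} → y ≡ g x → y′ ≡ h x → c [ y ∷ y′ ∷ [] ]⇓ z → z ≡ f (g x) (h x)
    sound′ refl refl e = ⇓-deterministic e (correct _)

  module Search {r : ℕ → ℕ → ℕ} (r-computable : Computable₂ r)
                (unique : ∀ {t t′ a} → r t a ≡ 0 → r t′ a ≡ 0 → t ≡ t′) where
    private
      c : Rec 2
      c = proj₁ (Computable₂.computable r-computable)

      correct : ∀ t a → c [ t ∷ a ∷ [] ]⇓ r t a
      correct t a = proj₂ (Computable₂.computable r-computable) (t ∷ a ∷ [])

    search-sound : ∀ {t a} → μ c [ a ∷ [] ]⇓ t → r t a ≡ 0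
    search-sound (⇓-μ d _) = ⇓-deterministic (correct _ _) d

    search-complete : ∀ {t a} → r t a ≡ 0 → μ c [ a ∷ [] ]⇓ t
    search-complete {t} {a} eq = ⇓-μ (subst (c [ t ∷ a ∷ [] ]⇓_) eq (correct t a)) below
      where
      below : ∀ {i} → i < t → ∃ λ k → c [ i ∷ a ∷ [] ]⇓ suc k
      below {i} i<t with r i a in eqᵢ | correct i a
      ... | zero  | _ = contradiction (unique eqᵢ eq) (<⇒≢ i<t)
      ... | suc k | d = k , d

    -- The x at which the search on `a x` converges form the domain of p, a c.e. set, to which
    -- cohesiveness applies. Divergence of the program for a itself is discounted, being finite on
    -- C.
    ae-dichotomy : ∀ {a} → AeComputable a →
                   Ev (λ x → ∃ λ t → r t (a x) ≡ 0) ⊎ Ev (λ x → ¬ ∃ λ t → r t (a x) ≡ 0)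
    ae-dichotomy {a} A with proj₂ cohesive (dom p) (p , id , id)
      where
      p : Rec 1
      p = comp (μ c) (program A ∷ [])
    ... | inj₁ (i , ¬p) = inj₂ (Ev-map₂ (λ ¬d d (t , eq) → ¬d (t , ⇓-comp (d ∷ []) (search-complete eq)))
                                  (i , λ i≤j c d → ¬p _ i≤j (d , c)) (value-at A))
    ... | inj₂ (i , ¬¬p) = inj₁ (Ev-map found
                                  (i , λ i≤j c → decidable-stable em λ ¬d → ¬¬p _ i≤j (¬d , c)))
      where
      found : ∀ {x} → dom (comp (μ c) (program A ∷ [])) x → ∃ λ t → r t (a x) ≡ 0
      found (t , ⇓-comp (d ∷ []) e) with refl ← sound A d = t , search-sound e

  zero-dichotomy : ∀ {h} → AeComputable h → Ev (λ x → h x ≡ 0) ⊎ Ev (λ x → h x ≢ 0)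
  -- With r t a = t + a, a witness t exists iff a = 0, and then t = 0.
  zero-dichotomy {h} H with Search.ae-dichotomy +-computable
      (λ {t} {t′} eq eq′ → trans (m+n≡0⇒m≡0 t eq) (sym (m+n≡0⇒m≡0 t′ eq′))) H
  ... | inj₁ ev = inj₁ (Ev-map (λ (t , eq) → m+n≡0⇒n≡0 t eq) ev)
  ... | inj₂ ev = inj₂ (Ev-map (λ ¬z eq → ¬z (0 , eq)) ev)

  value : Rec 1 → ℕ → ℕ
  value c x with em {dom c x}
  ... | yes (y , _) = y
  -- The default is a point, so that `val-point` holds at every x.
  ... | no _        = pair 0 0

  value-unique : ∀ {c x y} → c [ x ∷ [] ]⇓ y → y ≡ value c x
  value-unique {c} {x} {y} d with em {dom c x}
  ... | yes (_ , e) = ⇓-deterministic d e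
  ... | no ¬d       = contradiction (y , d) ¬d

  val : D → ℕ → ℕ
  val φ = value (code φ)

  val-ae : ∀ φ → AeComputable (val φ)
  val-ae φ = record { program = code φ ; sound = value-unique ; defined = ⊆*⇒Ev (domain φ) }

  val-point : ∀ φ x → Point (val φ x)
  val-point φ x with em {dom (code φ) x}
  ... | yes (_ , d) = into φ d
  ... | no _        = point-bottom 0

  element : ∀ {h} (H : AeComputable h) → (∀ {x} → dom (program H) x → Point (h x)) →
            ∃ λ φ → Ev λ x → val φ x ≡ h x
  element {h} H point = φ , Ev-map (λ d → sym (value-unique d)) (value-at H)
    where
    φ : D
    φ = record
      { code   = program H
      ; into   = λ d → subst Point (sym (sound H d)) (point (_ , d))
      ; domain = Ev⇒⊆* (defined H)
      }

  ae-bottom : ∀ {a} → AeComputable a → AeComputable (λ x → pair (a x) 0)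
  ae-bottom = ae-app₁ {f = λ a → pair a 0} (unary (app₂ pair-computable (var #0) (const-computable 0)))

  bottomElement : ∀ {a} → AeComputable a → ∃ λ φ → Ev λ x → val φ x ≡ pair (a x) 0
  bottomElement A = element (ae-bottom A) λ _ → point-bottom _

  open Search selfRun-computable (λ {t} {t′} → selfRun-unique {t} {t′})

  -- The search yields the correct time wherever it converges, and by hypothesis it converges almost
  -- everywhere on C.
  ae-time : ∀ {a} → AeComputable a → Ev (λ x → SelfHalting (a x)) → AeComputable (λ x → time (a x))
  ae-time {a} A halts = record
    { program = comp sucᶜ (comp (μ c) (program A ∷ []) ∷ [])
    ; sound   = λ { (⇓-comp (⇓-comp (d ∷ []) e ∷ []) ⇓-suc) → sound′ (sound A d) e }
    ; defined = Ev-map₂ (λ d (t , eq) → suc t , ⇓-comp (⇓-comp (d ∷ []) (search-complete eq) ∷ []) ⇓-suc)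
                  (value-at A) halts
    }
    where
    c : Rec 2
    c = proj₁ (Computable₂.computable selfRun-computable)
    sound′ : ∀ {x y t} → y ≡ a x → μ c [ y ∷ [] ]⇓ t → suc t ≡ time (a x)
    sound′ {t = t} refl e = sym (time-halting {t} (search-sound e))

  topElement : ∀ {a} → AeComputable a → ∃ λ φ → Ev λ x → val φ x ≡ topPoint (a x)
  topElement {a} A with ae-dichotomy A
  ... | inj₁ halts = element (ae-app₂ pair-computable A (ae-time A halts)) λ _ → topPoint-point _
  ... | inj₂ loops with φ , eq ← bottomElement A =
    φ , Ev-map₂ (λ e ¬h → trans e (cong (pair _) (sym (time-looping ¬h)))) eq loops

  height : D → ℕ → ℕ
  height φ x = rank (val φ x)

  -- Comparing heights amounts to comparing the computable keys; if neither strict inequality holds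
  -- almost everywhere, the keys agree.
  trichotomy : ∀ φ ψ → Ev (λ x → height φ x < height ψ x) ⊎
                       Ev (λ x → height φ x ≡ height ψ x) ⊎
                       Ev (λ x → height ψ x < height φ x)
  trichotomy φ ψ with below φ ψ | below ψ φ
    where
    below : ∀ φ ψ → Ev (λ x → suc (key (val φ x)) ∸ key (val ψ x) ≡ 0) ⊎
                    Ev (λ x → suc (key (val φ x)) ∸ key (val ψ x) ≢ 0)
    below φ ψ = zero-dichotomy (ae-app₂ ∸-computable
      (ae-app₁ suc-computable (ae-app₁ key-computable (val-ae φ))) (ae-app₁ key-computable (val-ae ψ)))
  ... | inj₁ lt  | _        = inj₁ (Ev-map (λ {x} e → rank-mono (val-point φ x) (val-point ψ x) (m∸n≡0⇒m≤n e)) lt)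
  ... | inj₂ _   | inj₁ gt  = inj₂ (inj₂ (Ev-map (λ {x} e → rank-mono (val-point ψ x) (val-point φ x) (m∸n≡0⇒m≤n e)) gt))
  ... | inj₂ nlt | inj₂ ngt = inj₂ (inj₁ (Ev-map₂ same nlt ngt))
    where
    same : ∀ {x} → suc (key (val φ x)) ∸ key (val ψ x) ≢ 0 → suc (key (val ψ x)) ∸ key (val φ x) ≢ 0 →
            height φ x ≡ height ψ x
    same {x} p q = cong rank (key-injective (val-point φ x) (val-point ψ x)
      (≤-antisym (s≤s⁻¹ (m∸n≢0⇒n<m q)) (s≤s⁻¹ (m∸n≢0⇒n<m p))))

  fiber-ae : ∀ φ → AeComputable (λ x → π₁ (val φ x))
  fiber-ae φ = ae-app₁ π₁-computable (val-ae φ)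

  -- φ is compared with the top θ of its own fibre. If φ is below, θ is the successor; if they
  -- agree, the next bottom is.
  successor : ∀ φ → ∃ λ ψ → Ev λ x → height ψ x ≡ suc (height φ x)
  successor φ with topElement (fiber-ae φ)
  ... | θ , θ-top with trichotomy φ θ
  ... | inj₁ lt        = θ , Ev-map₂ above-bottom θ-top lt
    where
    above-bottom : ∀ {x} → val θ x ≡ topPoint (π₁ (val φ x)) → height φ x < height θ x →
                   height θ x ≡ suc (height φ x)
    above-bottom {x} eq lt = ≤-antisym (begin
      height θ x                      ≤⟨ rank-upper (val θ x) ⟩
      suc (base (π₁ (val θ x)))       ≡⟨ cong (λ z → suc (base z)) (trans (cong π₁ eq) (π₁-pair _ _)) ⟩
      suc (base (π₁ (val φ x)))       ≤⟨ s≤s (rank-lower (val φ x)) ⟩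
      suc (height φ x)                ∎) lt
      where open ≤-Reasoning
  ... | inj₂ (inj₁ eq)
    with ψ , ψ-bottom ← bottomElement (ae-app₁ suc-computable (fiber-ae φ)) =
    ψ , Ev-map₂ (λ e e′ → trans e (cong suc (sym e′)))
          (Ev-map (λ e → trans (cong rank e) (rank-nextBottom _)) ψ-bottom)
          (Ev-map₂ (λ e e′ → trans e (cong rank e′)) eq θ-top)
  ... | inj₂ (inj₂ gt) = ⊥-elim (Ev-proper (Ev-map₂ {R = λ _ → ⊥} (λ {x} e gt →
          n≮n _ (<-≤-trans gt (≤-trans (rank-≤-topPoint (val-point φ x))
            (≤-reflexive (sym (cong rank e)))))) θ-top gt))

  -- The mirror image of `successor`. Positivity keeps a bottom point away from fibre 0, where
  -- `pred` does not move.
  predecessor : ∀ φ → Ev (λ x → 0 < height φ x) → ∃ λ ψ → Ev λ x → suc (height ψ x) ≡ height φ x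
  predecessor φ positive with bottomElement (fiber-ae φ)
  ... | θ , θ-bottom with trichotomy θ φ
  ... | inj₁ lt = θ , Ev-map₂ (λ {x} e lt → ≤-antisym lt (≤-trans (rank-upper (val φ x))
                    (s≤s (≤-reflexive (sym (trans (cong rank e) (rank-bottom _))))))) θ-bottom lt
  ... | inj₂ (inj₂ gt) = ⊥-elim (Ev-proper (Ev-map₂ {R = λ _ → ⊥} (λ {x} e gt → n≮n _ (<-≤-trans gt
                          (≤-trans (≤-reflexive (trans (cong rank e) (rank-bottom _)))
                            (rank-lower (val φ x))))) θ-bottom gt))
  ... | inj₂ (inj₁ eq)
    with ψ , ψ-top ← topElement (ae-app₁ pred-computable (fiber-ae φ)) =
    ψ , Ev-map₂ {P = λ x → height φ x ≡ base (π₁ (val φ x)) × 0 < height φ x}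
          (λ (e , pos) e′ → trans (cong (λ m → suc (rank m)) e′) (step-down _ e pos))
          (Ev-map₂ _,_ (Ev-map₂ (λ e e′ → trans (sym e) (trans (cong rank e′) (rank-bottom _))) eq θ-bottom) positive)
          ψ-top
    where
    step-down : ∀ a {k} → k ≡ base a → 0 < k → suc (rank (topPoint (pred a))) ≡ k
    step-down zero    refl ()
    step-down (suc a) refl _ = cong suc (rank-topPoint a)

  zeroElement : ∃ λ φ → Ev λ x → height φ x ≡ 0
  zeroElement
    with φ , eq ← bottomElement (ae-app₁ (unary (const-computable 0)) ae-id) =
    φ , Ev-map (λ e → trans (cong rank e) (rank-bottom 0)) eq

  -- Infinite distance, density and unboundedness

  infix 4 _≪_
  _≪_ : D → D → Set
  φ ≪ ψ = ∀ n → Ev λ x → height φ x + n ≤ height ψ x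

  -- If b came before k + a, `base` would gain at most 2k between a and b. The 2 on the left
  -- outweighs the `suc` on the right, which allows for a top point over b.
  base-gap : ∀ {a b} k → base a + (2 + 2 * k) ≤ suc (base b) → k + a ≤ b
  base-gap {a} {b} k le with k + a ≤? b
  ... | yes k+a≤b = k+a≤b
  ... | no k+a≰b  = contradiction (begin-strict
    suc (base b)              ≤⟨ s≤s (base-mono-≤ (<⇒≤ (≰⇒> k+a≰b))) ⟩
    suc (base (k + a))        ≤⟨ s≤s (base-upper a k) ⟩
    suc (2 * k + base a)      <⟨ n<1+n _ ⟩
    2 + 2 * k + base a        ≡⟨ +-comm (2 + 2 * k) (base a) ⟩
    base a + (2 + 2 * k)      ≤⟨ le ⟩
    suc (base b)              ∎) (n≮n _)
    where open ≤-Reasoning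

  -- The midpoint is taken between fibre indices. A rank gap of about 4n gives an index gap of about
  -- 2n, hence n fibres, and so rank at least n, on either side.
  dense : ∀ {φ ψ} → φ ≪ ψ → ∃ λ θ → φ ≪ θ × θ ≪ ψ
  dense {φ} {ψ} φ≪ψ
    with θ , mid ← bottomElement (ae-app₁ half-computable (ae-app₂ +-computable (fiber-ae φ) (fiber-ae ψ))) =
    θ , (λ n → Ev-map₂ (λ {x} → lower n x) (φ≪ψ _) mid) , (λ n → Ev-map₂ (λ {x} → upper n x) (φ≪ψ _) mid)
    where
    open ≤-Reasoning
    open +-*-Solver
    a b m : ℕ → ℕ
    a x = π₁ (val φ x)
    b x = π₁ (val ψ x)
    m x = half (a x + b x)

    gap : ∀ k x → height φ x + (2 + 2 * k) ≤ height ψ x → k + a x ≤ b x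
    gap k x le = base-gap k (≤-trans (+-monoˡ-≤ _ (rank-lower (val φ x))) (≤-trans le (rank-upper (val ψ x))))

    lower-index : ∀ n a b → (suc n + suc n) + a ≤ b → suc n + a ≤ half (a + b)
    lower-index n a b le with suc n + a ≤? half (a + b)
    ... | yes p = p
    ... | no ¬p = contradiction (begin-strict
      a + b                               ≤⟨ proj₂ (half-bounds (a + b)) ⟩
      suc (half (a + b) + half (a + b))   ≤⟨ s≤s (+-mono-≤ (s≤s⁻¹ (≰⇒> ¬p)) (s≤s⁻¹ (≰⇒> ¬p))) ⟩
      suc ((n + a) + (n + a))             <⟨ n<1+n _ ⟩
      2 + ((n + a) + (n + a))             ≡⟨ solve 2 (λ n a → con 2 :+ ((n :+ a) :+ (n :+ a)) :=
                                               a :+ (((con 1 :+ n) :+ (con 1 :+ n)) :+ a)) refl n a ⟩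
      a + ((suc n + suc n) + a)           ≤⟨ +-monoʳ-≤ a le ⟩
      a + b                               ∎) (n≮n _)

    upper-index : ∀ n a b → (n + n) + a ≤ b → n + half (a + b) ≤ b
    upper-index n a b le with n + half (a + b) ≤? b
    ... | yes p = p
    ... | no ¬p = contradiction (begin-strict
      b + b                                    <⟨ +-mono-< (≰⇒> ¬p) (≰⇒> ¬p) ⟩
      (n + half (a + b)) + (n + half (a + b))  ≡⟨ solve 2 (λ n h → (n :+ h) :+ (n :+ h) :=
                                                    (n :+ n) :+ (h :+ h)) refl n (half (a + b)) ⟩
      (n + n) + (half (a + b) + half (a + b))  ≤⟨ +-monoʳ-≤ (n + n) (proj₁ (half-bounds (a + b))) ⟩
      (n + n) + (a + b)                        ≡⟨ +-assoc (n + n) a b ⟨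
      (n + n) + a + b                          ≤⟨ +-monoˡ-≤ b le ⟩
      b + b                                    ∎) (n≮n _)

    -- Since φ may be a top point, one more fibre is required here than in `upper`, where θ is a
    -- bottom point.
    lower : ∀ n x → height φ x + (2 + 2 * (suc n + suc n)) ≤ height ψ x →
            val θ x ≡ pair (m x) 0 → height φ x + n ≤ height θ x
    lower n x le e = begin
      height φ x + n           ≤⟨ +-monoˡ-≤ n (rank-upper (val φ x)) ⟩
      suc (base (a x)) + n     ≡⟨ +-suc (base (a x)) n ⟨
      base (a x) + suc n       ≤⟨ base-lower (a x) (suc n) ⟩
      base (suc n + a x)       ≤⟨ base-mono-≤ (lower-index n (a x) (b x) (gap (suc n + suc n) x le)) ⟩
      base (m x)               ≡⟨ trans (cong rank e) (rank-bottom (m x)) ⟨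
      height θ x               ∎

    upper : ∀ n x → height φ x + (2 + 2 * (n + n)) ≤ height ψ x →
            val θ x ≡ pair (m x) 0 → height θ x + n ≤ height ψ x
    upper n x le e = begin
      height θ x + n           ≡⟨ cong (_+ n) (trans (cong rank e) (rank-bottom (m x))) ⟩
      base (m x) + n           ≤⟨ base-lower (m x) n ⟩
      base (n + m x)           ≤⟨ base-mono-≤ (upper-index n (a x) (b x) (gap (n + n) x le)) ⟩
      base (b x)               ≤⟨ rank-lower (val ψ x) ⟩
      height ψ x               ∎

  -- Moving up by x fibres at argument x eventually exceeds every fixed distance; the `suc` in
  -- `suc n` allows for φ being a top point.
  unbounded : ∀ φ → ∃ λ θ → φ ≪ θ
  unbounded φ with θ , eq ← bottomElement (ae-app₂ +-computable ae-id (fiber-ae φ)) =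
    θ , λ n → Ev-map₂ (λ {x} e le → begin
      height φ x + n                    ≤⟨ +-monoˡ-≤ n (rank-upper (val φ x)) ⟩
      suc (base (π₁ (val φ x))) + n     ≡⟨ +-suc (base (π₁ (val φ x))) n ⟨
      base (π₁ (val φ x)) + suc n       ≤⟨ +-monoʳ-≤ (base (π₁ (val φ x))) le ⟩
      base (π₁ (val φ x)) + x           ≤⟨ base-lower (π₁ (val φ x)) x ⟩
      base (x + π₁ (val φ x))           ≡⟨ trans (cong rank e) (rank-bottom _) ⟨
      height θ x                        ∎) eq (Ev-large (suc n))
    where open ≤-Reasoning

  heights-equal⇒=C : ∀ {φ ψ} → Ev (λ x → height φ x ≡ height ψ x) → φ =C ψ
  heights-equal⇒=C {φ} {ψ} eq = Ev⇒⊆* (Ev-map₂ {P = λ x → height φ x ≡ height ψ x × code φ [ x ∷ [] ]⇓ val φ x}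
    (λ {x} (e , d) d′ → val φ x , d ,
      subst (code ψ [ x ∷ [] ]⇓_) (sym (rank-injective (val-point φ x) (val-point ψ x) e)) d′)
    (Ev-map₂ _,_ eq (value-at (val-ae φ))) (value-at (val-ae ψ)))

  =C⇒heights-equal : ∀ {φ ψ} → φ =C ψ → Ev (λ x → height φ x ≡ height ψ x)
  =C⇒heights-equal φ=ψ = Ev-map (λ (y , d , d′) →
    cong rank (trans (sym (value-unique d)) (value-unique d′))) (⊆*⇒Ev φ=ψ)

  heights-less⇒<C : ∀ {φ ψ} → Ev (λ x → height φ x < height ψ x) → φ <C ψ
  heights-less⇒<C {φ} {ψ} lt = Ev⇒⊆* (Ev-map₂ {P = λ x → height φ x < height ψ x × code φ [ x ∷ [] ]⇓ val φ x}
    (λ {x} (e , d) d′ → val φ x , val ψ x , d , d′ , val-point φ x , val-point ψ x , e)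
    (Ev-map₂ _,_ lt (value-at (val-ae φ))) (value-at (val-ae ψ)))

  <C⇒heights-less : ∀ {φ ψ} → φ <C ψ → Ev (λ x → height φ x < height ψ x)
  <C⇒heights-less φ<ψ = Ev-map (λ (y , z , d , d′ , _ , _ , lt) →
    subst₂ (λ u v → rank u < rank v) (value-unique d) (value-unique d′) lt) (⊆*⇒Ev φ<ψ)

  compile-injective : ∀ {φ ψ} → compile (code φ) ≡ compile (code ψ) → Ev (λ x → height φ x ≡ height ψ x)
  compile-injective {φ} {ψ} eq = Ev-map₂ (λ d d′ → cong rank (compile-determines eq d d′))
    (value-at (val-ae φ)) (value-at (val-ae ψ))

-- Countable dense orders

-- A strict weak order: incomparability plays the role of equality.
record DenseOrder : Set₁ where
  infix 4 _⊏_ _~_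
  field
    Carrier : Set
    point   : Carrier
    _⊏_     : Carrier → Carrier → Set
    ⊏-irrefl  : ∀ {a} → ¬ (a ⊏ a)
    ⊏-trans   : ∀ {a b c} → a ⊏ b → b ⊏ c → a ⊏ c
    cotrans : ∀ {a b} → a ⊏ b → ∀ c → a ⊏ c ⊎ c ⊏ b
    dense   : ∀ {a b} → a ⊏ b → ∃ λ c → a ⊏ c × c ⊏ b
    above   : ∀ a → ∃ λ b → a ⊏ b
    below   : ∀ a → ∃ λ b → b ⊏ a

  _~_ : Carrier → Carrier → Set
  a ~ b = ¬ (a ⊏ b) × ¬ (b ⊏ a)

  asym : ∀ {a b} → a ⊏ b → ¬ (b ⊏ a)
  asym p q = ⊏-irrefl (⊏-trans p q)

  ~-sym : ∀ {a b} → a ~ b → b ~ a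
  ~-sym (p , q) = q , p

  ~-⊏ : ∀ {a b c} → a ~ b → a ⊏ c → b ⊏ c
  ~-⊏ {b = b} (¬a<b , _) a<c = [ (λ a<b → contradiction a<b ¬a<b) , id ]′ (cotrans a<c b)

  ⊏-~ : ∀ {a b c} → a ⊏ b → b ~ c → a ⊏ c
  ⊏-~ {c = c} a<b (_ , ¬c<b) = [ id , (λ c<b → contradiction c<b ¬c<b) ]′ (cotrans a<b c)

  ⊏-⋢ : ∀ {a b c} → a ⊏ b → ¬ (c ⊏ b) → a ⊏ c
  ⊏-⋢ {c = c} a<b ¬c<b = [ id , (λ c<b → contradiction c<b ¬c<b) ]′ (cotrans a<b c)

  ~-trans : ∀ {a b c} → a ~ b → b ~ c → a ~ c
  ~-trans a~b b~c = (λ a<c → proj₁ b~c (~-⊏ a~b a<c)) , (λ c<a → proj₂ b~c (⊏-~ c<a a~b))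

opposite : DenseOrder → DenseOrder
opposite A = record
  { Carrier = Carrier
  ; point   = point
  ; _⊏_     = flip _⊏_
  ; ⊏-irrefl  = ⊏-irrefl
  ; ⊏-trans   = flip ⊏-trans
  ; cotrans = λ b<a c → swap (cotrans b<a c)
  ; dense   = λ b<a → let c , p , q = dense b<a in c , q , p
  ; above   = below
  ; below   = above
  }
  where open DenseOrder A

module Insert (em : ExcludedMiddle 0ℓ) {I : Set} where

  module _ (A B : DenseOrder) (α : I → DenseOrder.Carrier A) (β : I → DenseOrder.Carrier B) where
    private
      module A = DenseOrder A
      module B = DenseOrder B

    -- A finite partial map is a list of indices read through α and β, so exchanging or reversing
    -- the two orders leaves the list unchanged.
    Monotone : List I → Set
    Monotone q = ∀ {i j} → i List.∈ q → j List.∈ q → α i A.⊏ α j → β i B.⊏ β j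

    Below Above Fits : A.Carrier → B.Carrier → List I → Set
    Below a b q = ∀ {i} → i List.∈ q → α i A.⊏ a → β i B.⊏ b
    Above a b q = ∀ {i} → i List.∈ q → a A.⊏ α i → b B.⊏ β i
    Fits  a b q = Below a b q × Above a b q

    -- Bounds are treated one by one: if b′ is not below the next bound, a point between b and that
    -- bound is also below all bounds treated before.
    lift : ∀ a q b → Above a b q → ∃ λ b′ → b B.⊏ b′ × Above a b′ q
    lift a []      b _     = let b′ , lt = B.above b in b′ , lt , λ ()
    lift a (i ∷ q) b b<ups with lift a q b (b<ups ∘ there)
    ... | b′ , b<b′ , b′<ups with em {a A.⊏ α i} | em {b′ B.⊏ β i}
    ...   | no ¬a<i | _         = b′ , b<b′ , λ { (here refl) a<i → contradiction a<i ¬a<i ; (there j) → b′<ups j }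
    ...   | yes a<i | yes b′<i  = b′ , b<b′ , λ { (here refl) _ → b′<i ; (there j) → b′<ups j }
    ...   | yes a<i | no ¬b′<i with b″ , b<b″ , b″<i ← B.dense (b<ups (here refl) a<i) =
      b″ , b<b″ , λ { (here refl) _ → b″<i ; (there j) a<j → B.⊏-trans (B.⊏-⋢ b″<i ¬b′<i) (b′<ups j a<j) }

    -- If β i is not yet below b, all old lower bounds are below β i, and lifting β i itself gives
    -- the new point.
    insert-lower : ∀ {a b i q} → Monotone (i ∷ q) → α i A.⊏ a → Fits a b q → ∃ λ b′ → Fits a b′ (i ∷ q)
    insert-lower {a} {b} {i} {q} mono i<a (lo , up) with em {β i B.⊏ b}
    ... | yes i<b = b , (λ { (here refl) _ → i<b ; (there j) → lo j }) ,
                        (λ { (here refl) a<i → contradiction a<i (A.asym i<a) ; (there j) → up j })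
    ... | no ¬i<b with b′ , i<b′ , up′ ← lift a q (β i) (λ j a<j → mono (here refl) (there j) (A.⊏-trans i<a a<j)) =
      b′ , (λ { (here refl) _ → i<b′ ; (there j) j<a → B.⊏-trans (B.⊏-⋢ (lo j j<a) ¬i<b) i<b′ }) ,
           (λ { (here refl) a<i → contradiction a<i (A.asym i<a) ; (there j) → up′ j })

    monotone-∷ : ∀ {i q} → Monotone q → Fits (α i) (β i) q → Monotone (i ∷ q)
    monotone-∷ mono (lo , up) (here refl) (here refl) lt = contradiction lt A.⊏-irrefl
    monotone-∷ mono (lo , up) (here refl) (there k)   lt = up k lt
    monotone-∷ mono (lo , up) (there j)   (here refl) lt = lo j lt
    monotone-∷ mono (lo , up) (there j)   (there k)   lt = mono j k lt

  module _ (A B : DenseOrder) (α : I → DenseOrder.Carrier A) (β : I → DenseOrder.Carrier B) where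
    private
      module A = DenseOrder A
      module B = DenseOrder B

    insert : ∀ a q → Monotone A B α β q → (∀ {i} → i List.∈ q → ¬ (α i A.~ a)) →
             ∃ λ b → Fits A B α β a b q
    insert a []      mono new = B.point , (λ ()) , (λ ())
    insert a (i ∷ q) mono new
      with b , fits ← insert a q (λ j k → mono (there j) (there k)) (new ∘ there)
      with em {α i A.⊏ a} | em {a A.⊏ α i}
    ... | yes i<a | _       = insert-lower A B α β mono i<a fits
    ... | no ¬i<a | no ¬a<i = contradiction (¬i<a , ¬a<i) (new (here refl))
    -- In the opposite orders the upper constraint becomes a lower one.
    ... | no _    | yes a<i
      with b′ , up , lo ← insert-lower (opposite A) (opposite B) α β (λ j k → mono k j) a<i (proj₂ fits , proj₁ fits) =
      b′ , lo , up

  module _ (A B : DenseOrder) (α : I → DenseOrder.Carrier A) (β : I → DenseOrder.Carrier B) where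
    private
      module A = DenseOrder A
      module B = DenseOrder B

    -- A point equivalent to a matched one takes over its partner. A new point is strictly
    -- comparable with every matched one, so the converse implications follow from asymmetry.
    extend : ∀ a q → Monotone A B α β q → Monotone B A β α q →
             ∃ λ b → Fits A B α β a b q × Fits B A β α b a q
    extend a q mono mono′ with em {∃ λ i → i List.∈ q × α i A.~ a}
    ... | yes (i , i∈q , i~a) = β i ,
      ((λ j∈q j<a → mono j∈q i∈q (A.⊏-~ j<a (A.~-sym i~a))) ,
       (λ j∈q a<j → mono i∈q j∈q (A.~-⊏ (A.~-sym i~a) a<j))) ,
      ((λ j∈q j<i → A.⊏-~ (mono′ j∈q i∈q j<i) i~a) ,
       (λ j∈q i<j → A.~-⊏ i~a (mono′ i∈q j∈q i<j)))
    ... | no new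
      with b , lo , up ← insert A B α β a q mono (λ i∈q i~a → new (_ , i∈q , i~a)) =
      b , (lo , up) ,
      (λ j∈q j<b → decidable-stable em λ ¬j<a →
        new (_ , j∈q , ¬j<a , λ a<j → B.asym j<b (up j∈q a<j))) ,
      (λ j∈q b<j → decidable-stable em λ ¬a<j →
        new (_ , j∈q , (λ j<a → B.asym b<j (lo j∈q j<a)) , ¬a<j))

module BackAndForth (em : ExcludedMiddle 0ℓ) (A B : DenseOrder) where
  private
    module A = DenseOrder A
    module B = DenseOrder B
  open Insert em {A.Carrier × B.Carrier}

  module _ (enumA : ℕ → A.Carrier) (enumA-onto : ∀ a → ∃ λ n → enumA n A.~ a)
           (enumB : ℕ → B.Carrier) (enumB-onto : ∀ b → ∃ λ n → enumB n B.~ b) where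

    PartialIso : List (A.Carrier × B.Carrier) → Set
    PartialIso q = Monotone A B proj₁ proj₂ q × Monotone B A proj₂ proj₁ q

    forth : ∀ {q} → PartialIso q → ∀ a → ∃ λ b → PartialIso ((a , b) ∷ q)
    forth {q} (mono , mono′) a with extend A B proj₁ proj₂ a q mono mono′
    ... | b , fits , fits′ =
      b , monotone-∷ A B proj₁ proj₂ mono fits , monotone-∷ B A proj₂ proj₁ mono′ fits′

    back : ∀ {q} → PartialIso q → ∀ b → ∃ λ a → PartialIso ((a , b) ∷ q)
    back {q} (mono , mono′) b with extend B A proj₂ proj₁ b q mono′ mono
    ... | a , fits′ , fits =
      a , monotone-∷ A B proj₁ proj₂ mono fits , monotone-∷ B A proj₂ proj₁ mono′ fits′

    stage : ℕ → ∃ PartialIso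
    stage zero    = [] , (λ ()) , (λ ())
    stage (suc n) =
      let q , iso    = stage n
          b , iso′   = forth iso (enumA n)
          a , iso″   = back iso′ (enumB n)
      in (a , enumB n) ∷ (enumA n , b) ∷ q , iso″

    stage-mono : ∀ {m n x} → m ≤ n → x List.∈ proj₁ (stage m) → x List.∈ proj₁ (stage n)
    stage-mono {n = zero}  z≤n x∈ = x∈
    stage-mono {m} {suc n} m≤n x∈ with m≤n⇒m<n∨m≡n m≤n
    ... | inj₁ m<1+n = there (there (stage-mono (s≤s⁻¹ m<1+n) x∈))
    ... | inj₂ refl  = x∈

    Matched : A.Carrier × B.Carrier → Set
    Matched x = ∃ λ n → x List.∈ proj₁ (stage n)

    matched-mono : ∀ {a b a′ b′} → Matched (a , b) → Matched (a′ , b′) → a A.⊏ a′ → b B.⊏ b′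
    matched-mono (m , x) (n , y) = proj₁ (proj₂ (stage (m ⊔ n)))
      (stage-mono (m≤m⊔n m n) x) (stage-mono (m≤n⊔m m n) y)

    matched-cancel : ∀ {a b a′ b′} → Matched (a , b) → Matched (a′ , b′) → b B.⊏ b′ → a A.⊏ a′
    matched-cancel (m , x) (n , y) = proj₂ (proj₂ (stage (m ⊔ n)))
      (stage-mono (m≤m⊔n m n) x) (stage-mono (m≤n⊔m m n) y)

    -- The enumeration meets a only up to `~`, so the partner of an equivalent a′ is taken.
    image : ∀ a → ∃ λ b → ∃ λ a′ → a′ A.~ a × Matched (a′ , b)
    image a with n , n~a ← enumA-onto a = _ , _ , n~a , suc n , there (here refl)

    map : A.Carrier → B.Carrier
    map a = proj₁ (image a)

    map-mono : ∀ {a a′} → a A.⊏ a′ → map a B.⊏ map a′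
    map-mono {a} {a′} lt =
      let _ , _ , ~a  , m  = image a
          _ , _ , ~a′ , m′ = image a′
      in matched-mono m m′ (A.⊏-~ (A.~-⊏ (A.~-sym ~a) lt) (A.~-sym ~a′))

    map-cancel : ∀ {a a′} → map a B.⊏ map a′ → a A.⊏ a′
    map-cancel {a} {a′} lt =
      let _ , _ , ~a  , m  = image a
          _ , _ , ~a′ , m′ = image a′
      in A.⊏-~ (A.~-⊏ ~a (matched-cancel m m′ lt)) ~a′

    map-matched : ∀ a {b} → Matched (a , b) → map a B.~ b
    map-matched a m = let _ , _ , ~a , m′ = image a in
      (λ lt → proj₁ ~a (matched-cancel m′ m lt)) , (λ lt → proj₂ ~a (matched-cancel m m′ lt))

    map-onto : ∀ b → ∃ λ a → map a B.~ b
    map-onto b with n , n~b ← enumB-onto b =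
      _ , B.~-trans (map-matched _ (suc n , here refl)) n~b

-- The order type of the cohesive power

ℚ-dense : DenseOrder
ℚ-dense = record
  { Carrier = ℚ
  ; point   = 0ℚ
  ; _⊏_     = ℚ._<_
  ; ⊏-irrefl = ℚ.<-irrefl refl
  ; ⊏-trans = ℚ.<-trans
  ; cotrans = cotrans
  ; dense   = ℚ.<-dense
  ; above   = λ p → p ℚ.+ 1ℚ , subst (ℚ._< p ℚ.+ 1ℚ) (ℚ.+-identityʳ p) (ℚ.+-monoʳ-< p (ℚ.positive⁻¹ 1ℚ))
  ; below   = λ p → p ℚ.+ ℚ.- 1ℚ , subst (p ℚ.+ ℚ.- 1ℚ ℚ.<_) (ℚ.+-identityʳ p) (ℚ.+-monoʳ-< p (ℚ.negative⁻¹ (ℚ.- 1ℚ)))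
  }
  where
  cotrans : ∀ {p q} → p ℚ.< q → ∀ r → p ℚ.< r ⊎ r ℚ.< q
  cotrans {p} p<q r with ℚ.<-cmp p r
  ... | tri< p<r _ _  = inj₁ p<r
  ... | tri≈ _ refl _ = inj₂ p<q
  ... | tri> _ _ r<p  = inj₂ (ℚ.<-trans r<p p<q)

ℚ-~⇒≡ : ∀ {p q} → DenseOrder._~_ ℚ-dense p q → p ≡ q
ℚ-~⇒≡ {p} {q} (p≮q , q≮p) with ℚ.<-cmp p q
... | tri< p<q _ _ = contradiction p<q p≮q
... | tri≈ _ p≡q _ = p≡q
... | tri> _ _ q<p = contradiction q<p q≮p

-- Enumerating ℚ and shifting by integers

decodeℤ : ℕ → ℤ
decodeℤ k = π₁ k ⊖ π₂ k

encodeℤ : ℤ → ℕ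
encodeℤ (+ n)    = pair n 0
encodeℤ -[1+ n ] = pair 0 (suc n)

decodeℤ-encodeℤ : ∀ z → decodeℤ (encodeℤ z) ≡ z
decodeℤ-encodeℤ (+ n)    = cong₂ _⊖_ (π₁-pair n 0) (π₂-pair n 0)
decodeℤ-encodeℤ -[1+ n ] = cong₂ _⊖_ (π₁-pair 0 (suc n)) (π₂-pair 0 (suc n))

decodeℚ : ℕ → ℚ
decodeℚ k = decodeℤ (π₁ k) ℚ./ suc (π₂ k)

decodeℚ-onto : ∀ p → ∃ λ k → decodeℚ k ≡ p
decodeℚ-onto p@(mkℚ z d _) = pair (encodeℤ z) d , trans
  (cong₂ (λ y e → y ℚ./ suc e) (trans (cong decodeℤ (π₁-pair _ d)) (decodeℤ-encodeℤ z)) (π₂-pair _ d))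
  (ℚ.↥p/↧p≡p p)

-- b = a + z over the integers, with negative z moved to the other side to avoid truncated
-- subtraction.
Shift : ℕ → ℤ → ℕ → Set
Shift a (+ n)    b = b ≡ a + n
Shift a -[1+ n ] b = a ≡ b + suc n

shift-upper : ∀ {a b} z → Shift a z b → b ≤ a + ∣ z ∣
shift-upper (+ n)    eq   = ≤-reflexive eq
shift-upper -[1+ n ] refl = ≤-trans (m≤m+n _ (suc n)) (m≤m+n _ (suc n))

shift-lower : ∀ {a b} z → Shift a z b → a ≤ b + ∣ z ∣
shift-lower (+ n)    refl = ≤-trans (m≤m+n _ n) (m≤m+n _ n)
shift-lower -[1+ n ] eq   = ≤-reflexive eq

shift-functional : ∀ {a b b′} z → Shift a z b → Shift a z b′ → b ≡ b′
shift-functional (+ n)    eq eq′ = trans eq (sym eq′)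
shift-functional {b = b} {b′} -[1+ n ] eq eq′ = +-cancelʳ-≡ (suc n) b b′ (trans (sym eq) eq′)

shift-mono : ∀ {a b b′ z z′} → z ℤ.< z′ → Shift a z b → Shift a z′ b′ → b < b′
shift-mono {a} (+<+ m<n) refl refl = +-monoʳ-< a m<n
shift-mono {b = b} (-<+ {m} {n}) refl refl = ≤-trans (m<m+n b (s≤s z≤n)) (m≤m+n (b + suc m) n)
shift-mono {b = b} {b′} (-<- {m} {n} n<m) refl eq =
  +-cancelʳ-< (suc n) b b′ (<-≤-trans (+-monoʳ-< b (s≤s n<m)) (≤-reflexive eq))

-- A family of functions ω → ℕ compared eventually, in the sense of a filter Ev.
record EventualOrder : Set₁ where
  infix 4 _≪_
  field
    Ev          : Pred ℕ 0ℓ → Set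
    Ev-map₂     : ∀ {P Q R : Pred ℕ 0ℓ} → (∀ {x} → P x → Q x → R x) → Ev P → Ev Q → Ev R
    Ev-always   : ∀ {P : Pred ℕ 0ℓ} → (∀ x → P x) → Ev P
    Ev-proper   : ¬ Ev (λ _ → ⊥)
    Carrier     : Set
    height      : Carrier → ℕ → ℕ
    trichotomy  : ∀ φ ψ → Ev (λ x → height φ x < height ψ x) ⊎
                          Ev (λ x → height φ x ≡ height ψ x) ⊎
                          Ev (λ x → height ψ x < height φ x)
    zeroElement : ∃ λ φ → Ev λ x → height φ x ≡ 0
    successor   : ∀ φ → ∃ λ ψ → Ev λ x → height ψ x ≡ suc (height φ x)
    predecessor : ∀ φ → Ev (λ x → 0 < height φ x) → ∃ λ ψ → Ev λ x → suc (height ψ x) ≡ height φ x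

  _≪_ : Carrier → Carrier → Set
  φ ≪ ψ = ∀ n → Ev λ x → height φ x + n ≤ height ψ x

  field
    dense       : ∀ {φ ψ} → φ ≪ ψ → ∃ λ θ → φ ≪ θ × θ ≪ ψ
    unbounded   : ∀ φ → ∃ λ θ → φ ≪ θ
    index       : Carrier → ℕ
    index-inj   : ∀ {φ ψ} → index φ ≡ index ψ → Ev λ x → height φ x ≡ height ψ x

  Ev-map : ∀ {P Q : Pred ℕ 0ℓ} → (∀ {x} → P x → Q x) → Ev P → Ev Q
  Ev-map f p = Ev-map₂ (λ p _ → f p) p p

module OrderType (em : ExcludedMiddle 0ℓ) (𝓔 : EventualOrder) where
  open EventualOrder 𝓔 renaming (Carrier to D)

  Ev-absurd : ∀ {P : Pred ℕ 0ℓ} {A : Set} → (∀ {x} → ¬ P x) → Ev P → A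
  Ev-absurd ¬p ev = ⊥-elim (Ev-proper (Ev-map ¬p ev))

  Ev-absurd₂ : ∀ {P Q : Pred ℕ 0ℓ} {A : Set} → (∀ {x} → P x → ¬ Q x) → Ev P → Ev Q → A
  Ev-absurd₂ ¬pq p q = ⊥-elim (Ev-proper (Ev-map₂ {R = λ _ → ⊥} ¬pq p q))

  Near : D → ℤ → D → Set
  Near φ z ψ = Ev λ x → Shift (height φ x) z (height ψ x)

  ≪-trans : ∀ {φ ψ θ} → φ ≪ ψ → ψ ≪ θ → φ ≪ θ
  ≪-trans p q n = Ev-map₂ (λ le le′ → ≤-trans le (≤-trans (m≤m+n _ 0) le′)) (p n) (q 0)

  ≪⇒< : ∀ {φ ψ} → φ ≪ ψ → Ev λ x → height φ x < height ψ x
  ≪⇒< {φ} p = Ev-map (λ {x} le → ≤-trans (≤-reflexive (+-comm 1 (height φ x))) le) (p 1)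

  ≪-irrefl : ∀ {φ} → ¬ (φ ≪ φ)
  ≪-irrefl {φ} p = Ev-absurd (λ {x} → n≮n (height φ x)) (≪⇒< p)

  near-≪ : ∀ {φ ψ θ} z → Near φ z θ → φ ≪ ψ → θ ≪ ψ
  near-≪ {φ} z near φ≪ψ n = Ev-map₂
    (λ {x} s le → ≤-trans (+-monoˡ-≤ n (shift-upper z s))
      (≤-trans (≤-reflexive (+-assoc (height φ x) ∣ z ∣ n)) le)) near (φ≪ψ (∣ z ∣ + n))

  ≪-near : ∀ {φ ψ θ} z → φ ≪ ψ → Near ψ z θ → φ ≪ θ
  ≪-near {φ} {ψ} {θ} z φ≪ψ near n = Ev-map₂
    (λ {x} le s → +-cancelʳ-≤ ∣ z ∣ (height φ x + n) (height θ x)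
      (≤-trans (≤-reflexive (+-assoc (height φ x) n ∣ z ∣)) (≤-trans le (shift-lower z s))))
    (φ≪ψ (n + ∣ z ∣)) near

  shiftUp : ∀ φ n → ∃ λ ψ → Near φ (+ n) ψ
  shiftUp φ zero    = φ , Ev-always λ x → sym (+-identityʳ _)
  shiftUp φ (suc n) with shiftUp φ n
  ... | ψ , near with successor ψ
  ... | θ , eq = θ , Ev-map₂ (λ {x} e e′ → trans e′ (trans (cong suc e) (sym (+-suc (height φ x) n)))) near eq

  -- If no finite distance is attained, induction on n compares ψ with the shift of φ by n: equality
  -- is excluded by assumption, and a smaller ψ by the previous stage.
  close-or-far : ∀ φ ψ → Ev (λ x → height φ x ≤ height ψ x) → φ ≪ ψ ⊎ ∃ λ n → Near φ (+ n) ψ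
  close-or-far φ ψ le with em {∃ λ n → Near φ (+ n) ψ}
  ... | yes near = inj₂ near
  ... | no ¬near = inj₁ far
    where
    far : φ ≪ ψ
    far zero    = Ev-map (λ {x} → ≤-trans (≤-reflexive (+-identityʳ _))) le
    far (suc n) with θ , near ← shiftUp φ n with trichotomy θ ψ
    ... | inj₁ lt        = Ev-map₂ (λ {x} e l → ≤-trans
                             (≤-reflexive (trans (+-suc (height φ x) n) (cong suc (sym e)))) l) near lt
    ... | inj₂ (inj₁ eq) = contradiction (n , Ev-map₂ (λ e e′ → trans (sym e′) e) near eq) ¬near
    ... | inj₂ (inj₂ gt) = Ev-absurd₂ {P = λ x → height φ x + n ≤ height ψ x × height θ x ≡ height φ x + n}
                             (λ (l , e) g → n≮n _ (<-≤-trans g (≤-trans (≤-reflexive e) l)))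
                             (Ev-map₂ _,_ (far n) near) gt

  compare-≪ : ∀ φ ψ → φ ≪ ψ ⊎ (∃ λ z → Near φ z ψ) ⊎ ψ ≪ φ
  compare-≪ φ ψ with trichotomy φ ψ
  ... | inj₁ lt with close-or-far φ ψ (Ev-map <⇒≤ lt)
  ...   | inj₁ far        = inj₁ far
  ...   | inj₂ (n , near) = inj₂ (inj₁ (+ n , near))
  compare-≪ φ ψ | inj₂ (inj₁ eq) = inj₂ (inj₁ (+ 0 , Ev-map (λ e → trans (sym e) (sym (+-identityʳ _))) eq))
  compare-≪ φ ψ | inj₂ (inj₂ gt) with close-or-far ψ φ (Ev-map <⇒≤ gt)
  ... | inj₁ far              = inj₂ (inj₂ far)
  ... | inj₂ (zero  , near)   = inj₂ (inj₁ (+ 0 , Ev-map (λ e → sym (trans (+-identityʳ _) (trans e (+-identityʳ _)))) near))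
  ... | inj₂ (suc n , near)   = inj₂ (inj₁ (-[1+ n ] , near))

  Nonstandard : D → Set
  Nonstandard φ = ∀ n → Ev λ x → n ≤ height φ x

  ≪⇒nonstandard : ∀ {φ ψ} → φ ≪ ψ → Nonstandard ψ
  ≪⇒nonstandard φ≪ψ n = Ev-map (≤-trans (m≤n+m n _)) (φ≪ψ n)

  zero≪ : ∀ {φ} → Nonstandard φ → proj₁ zeroElement ≪ φ
  zero≪ ns n = Ev-map₂ (λ e le → ≤-trans (≤-reflexive (cong (_+ n) e)) le) (proj₂ zeroElement) (ns n)

  shiftDown : ∀ φ → Nonstandard φ → ∀ n → ∃ λ ψ → Ev λ x → height φ x ≡ height ψ x + n
  shiftDown φ ns zero    = φ , Ev-always λ x → sym (+-identityʳ _)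
  shiftDown φ ns (suc n) with shiftDown φ ns n
  ... | ψ , eq with predecessor ψ (Ev-map₂ positive eq (ns (suc n)))
    where
    positive : ∀ {x} → height φ x ≡ height ψ x + n → suc n ≤ height φ x → 0 < height ψ x
    positive e le = +-cancelʳ-< n 0 _ (≤-trans le (≤-reflexive e))
  ...   | θ , eq′ = θ , Ev-map₂ (λ {x} e e′ → trans e (trans (cong (_+ n) (sym e′)) (sym (+-suc (height θ x) n)))) eq eq′

  shiftBy : ∀ φ → Nonstandard φ → ∀ z → ∃ λ ψ → Near φ z ψ
  shiftBy φ ns (+ n)    = shiftUp φ n
  shiftBy φ ns -[1+ n ] = shiftDown φ ns (suc n)

  infinite : ∃ Nonstandard
  infinite with φ , zero≪φ ← unbounded (proj₁ zeroElement) = φ , ≪⇒nonstandard zero≪φ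

  -- No quotient is formed: elements stand for their blocks, and incomparability means finite
  -- distance.
  blocks : DenseOrder
  blocks = record
    { Carrier = ∃ Nonstandard
    ; point   = infinite
    ; _⊏_     = λ (φ , _) (ψ , _) → φ ≪ ψ
    ; ⊏-irrefl = ≪-irrefl
    ; ⊏-trans = ≪-trans
    ; cotrans = λ φ≪ψ (θ , _) → cotrans φ≪ψ θ
    ; dense   = λ φ≪ψ → let θ , p , q = dense φ≪ψ in (θ , ≪⇒nonstandard p) , p , q
    ; above   = λ (φ , _) → let θ , p = unbounded φ in (θ , ≪⇒nonstandard p) , p
    -- Density above the zero element provides a lower block that is still nonstandard.
    ; below   = λ (φ , ns) → let θ , p , q = dense (zero≪ ns) in (θ , ≪⇒nonstandard p) , q
    }
    where
    cotrans : ∀ {φ ψ} → φ ≪ ψ → ∀ θ → φ ≪ θ ⊎ θ ≪ ψ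
    cotrans {φ} φ≪ψ θ with compare-≪ φ θ
    ... | inj₁ φ≪θ               = inj₁ φ≪θ
    ... | inj₂ (inj₁ (z , near)) = inj₂ (near-≪ z near φ≪ψ)
    ... | inj₂ (inj₂ θ≪φ)        = inj₂ (≪-trans θ≪φ φ≪ψ)

  open DenseOrder blocks using (_~_)

  near⇒~ : ∀ {φ ψ} z → Near (proj₁ φ) z (proj₁ ψ) → φ ~ ψ
  near⇒~ z near = (λ φ≪ψ → ≪-irrefl (near-≪ z near φ≪ψ)) , (λ ψ≪φ → ≪-irrefl (≪-near z ψ≪φ near))

  ~⇒near : ∀ {φ ψ} → φ ~ ψ → ∃ λ z → Near (proj₁ φ) z (proj₁ ψ)
  ~⇒near {φ , _} {ψ , _} (¬φ≪ψ , ¬ψ≪φ) with compare-≪ φ ψ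
  ... | inj₁ φ≪ψ        = contradiction φ≪ψ ¬φ≪ψ
  ... | inj₂ (inj₁ near) = near
  ... | inj₂ (inj₂ ψ≪φ) = contradiction ψ≪φ ¬ψ≪φ

  -- Elements sharing an index have heights equal almost everywhere, so any one of them serves;
  -- numbers that index nothing receive a default block.
  enumBlocks : ℕ → ∃ Nonstandard
  enumBlocks n with em {∃ λ (φ : ∃ Nonstandard) → index (proj₁ φ) ≡ n}
  ... | yes (φ , _) = φ
  ... | no _        = infinite

  enumBlocks-onto : ∀ φ → ∃ λ n → enumBlocks n ~ φ
  enumBlocks-onto φ = index (proj₁ φ) , onto
    where
    onto : enumBlocks (index (proj₁ φ)) ~ φ
    onto with em {∃ λ (ψ : ∃ Nonstandard) → index (proj₁ ψ) ≡ index (proj₁ φ)}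
    ... | yes (ψ , eq) = near⇒~ {ψ} {φ} (+ 0) (Ev-map (λ e → trans (sym e) (sym (+-identityʳ _)))
                           (index-inj eq))
    ... | no none      = contradiction (φ , refl) none

  module Cantor = BackAndForth em blocks ℚ-dense

  ℚ-onto : ∀ p → ∃ λ n → DenseOrder._~_ ℚ-dense (decodeℚ n) p
  ℚ-onto p with n , refl ← decodeℚ-onto p = n , ℚ.<-irrefl refl , ℚ.<-irrefl refl

  opaque
    block : ∃ Nonstandard → ℚ
    block = Cantor.map enumBlocks enumBlocks-onto decodeℚ ℚ-onto

    block-mono : ∀ {φ ψ} → proj₁ φ ≪ proj₁ ψ → block φ ℚ.< block ψ
    block-mono {φ} {ψ} = Cantor.map-mono enumBlocks enumBlocks-onto decodeℚ ℚ-onto {φ} {ψ}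

    block-cancel : ∀ {φ ψ} → block φ ℚ.< block ψ → proj₁ φ ≪ proj₁ ψ
    block-cancel {φ} {ψ} = Cantor.map-cancel enumBlocks enumBlocks-onto decodeℚ ℚ-onto {φ} {ψ}

    block-onto : ∀ p → ∃ λ φ → block φ ≡ p
    block-onto p = let φ , eq = Cantor.map-onto enumBlocks enumBlocks-onto decodeℚ ℚ-onto p in
      φ , ℚ-~⇒≡ eq

  representative : ℚ → ∃ Nonstandard
  representative p = proj₁ (block-onto p)

  block-representative : ∀ p → block (representative p) ≡ p
  block-representative p = proj₂ (block-onto p)

  -- Coordinates in ℕ + ℚ × ℤ

  Target : Set
  Target = ℕ ⊎ (ℚ × ℤ)

  -- In the second summand p names the block and z measures the distance from its chosen
  -- representative.
  Represents : D → Target → Set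
  Represents φ (inj₁ n)       = Ev λ x → height φ x ≡ n
  Represents φ (inj₂ (p , z)) = Near (proj₁ (representative p)) z φ

  represented : ∀ φ → ∃ (Represents φ)
  represented φ with compare-≪ (proj₁ zeroElement) φ
  ... | inj₁ zero≪φ = inj₂ (p , proj₁ near) , proj₂ near
    where
    φ′ : ∃ Nonstandard
    φ′ = φ , ≪⇒nonstandard zero≪φ
    p : ℚ
    p = block φ′
    near : ∃ λ z → Near (proj₁ (representative p)) z φ
    near = ~⇒near {representative p} {φ′}
      ((λ lt → ℚ.<-irrefl (block-representative p) (block-mono {representative p} {φ′} lt)) ,
       (λ gt → ℚ.<-irrefl (sym (block-representative p)) (block-mono {φ′} {representative p} gt)))
  ... | inj₂ (inj₁ (+ n , near)) =
    inj₁ n , Ev-map₂ (λ e e′ → trans e′ (cong (_+ n) e)) (proj₂ zeroElement) near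
  ... | inj₂ (inj₁ (-[1+ n ] , near)) =
    Ev-absurd₂ (λ {x} e e′ → contradiction (trans (sym (+-suc (height φ x) n)) (trans (sym e′) e)) λ ())
      (proj₂ zeroElement) near
  ... | inj₂ (inj₂ φ≪zero) =
    Ev-absurd₂ (λ e lt → contradiction (≤-trans lt (≤-reflexive e)) λ ()) (proj₂ zeroElement) (≪⇒< φ≪zero)

  represents-onto : ∀ t → ∃ λ φ → Represents φ t
  represents-onto (inj₁ n) with φ , near ← shiftUp (proj₁ zeroElement) n =
    φ , Ev-map₂ (λ e e′ → trans e′ (cong (_+ n) e)) (proj₂ zeroElement) near
  represents-onto (inj₂ (p , z)) = shiftBy _ (proj₂ (representative p)) z

  T : StrictTotalOrder 0ℓ 0ℓ 0ℓ
  T = ⊎-<-strictTotalOrder {d = 0ℓ} {0ℓ} {0ℓ} <-strictTotalOrder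
        (×-strictTotalOrder ℚ.<-strictTotalOrder ℤ.<-strictTotalOrder)

  open StrictTotalOrder T using () renaming (_≈_ to _≈ᵀ_; _<_ to _<ᵀ_; compare to compareᵀ)

  represents-cong : ∀ {φ ψ s t} → Represents φ s → Represents ψ t → s ≈ᵀ t →
                    Ev λ x → height φ x ≡ height ψ x
  represents-cong r r′ (inj₁ refl)          = Ev-map₂ (λ e e′ → trans e (sym e′)) r r′
  represents-cong {s = inj₂ (_ , z)} r r′ (inj₂ (refl , refl)) = Ev-map₂ (shift-functional z) r r′

  represents-mono : ∀ {φ ψ s t} → Represents φ s → Represents ψ t → s <ᵀ t →
                    Ev λ x → height φ x < height ψ x
  represents-mono r r′ (₁∼₁ m<n) = Ev-map₂ (λ { refl refl → m<n }) r r′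
  represents-mono {s = inj₁ n} {inj₂ (p , z)} r r′ ₁∼₂ =
    Ev-map₂ (λ { refl le → le }) r
      (≪⇒nonstandard (≪-near z (zero≪ (proj₂ (representative p))) r′) (suc n))
  represents-mono {s = inj₂ (p , z)} {inj₂ (q , z′)} r r′ (₂∼₂ (inj₁ p<q)) =
    ≪⇒< (near-≪ z r (≪-near z′ (block-cancel {representative p} {representative q}
      (subst₂ ℚ._<_ (sym (block-representative p)) (sym (block-representative q)) p<q)) r′))
  represents-mono r r′ (₂∼₂ (inj₂ (refl , z<z′))) = Ev-map₂ (shift-mono z<z′) r r′

  -- The target is totally ordered, so excluding the two strict cases by `represents-mono` suffices.
  represents-reflect-≡ : ∀ {φ ψ s t} → Represents φ s → Represents ψ t →
                         Ev (λ x → height φ x ≡ height ψ x) → s ≈ᵀ t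
  represents-reflect-≡ {s = s} {t} r r′ eq with compareᵀ s t
  ... | tri< s<t _ _ = Ev-absurd₂ (λ e lt → <⇒≢ lt e) eq (represents-mono r r′ s<t)
  ... | tri≈ _ s≈t _ = s≈t
  ... | tri> _ _ t<s = Ev-absurd₂ (λ e lt → <⇒≢ lt (sym e)) eq (represents-mono r′ r t<s)

  represents-reflect-< : ∀ {φ ψ s t} → Represents φ s → Represents ψ t →
                         Ev (λ x → height φ x < height ψ x) → s <ᵀ t
  represents-reflect-< {s = s} {t} r r′ lt with compareᵀ s t
  ... | tri< s<t _ _ = s<t
  ... | tri≈ _ s≈t _ = Ev-absurd₂ (λ l e → <⇒≢ l e) lt (represents-cong r r′ s≈t)
  ... | tri> _ _ t<s = Ev-absurd₂ (λ l l′ → <-asym l l′) lt (represents-mono r′ r t<s)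

  classify : D → Target
  classify φ = proj₁ (represented φ)

  classify-isOrderIsomorphism : IsOrderIsomorphism
    (λ φ ψ → Ev λ x → height φ x ≡ height ψ x) _≈ᵀ_
    (λ φ ψ → Ev λ x → height φ x < height ψ x) _<ᵀ_ classify
  classify-isOrderIsomorphism = record
    { isOrderMonomorphism = record
      { isOrderHomomorphism = record
        { cong = λ {φ} {ψ} → represents-reflect-≡ (rep φ) (rep ψ)
        ; mono = λ {φ} {ψ} → represents-reflect-< (rep φ) (rep ψ)
        }
      ; injective = λ {φ} {ψ} → represents-cong (rep φ) (rep ψ)
      ; cancel    = λ {φ} {ψ} → represents-mono (rep φ) (rep ψ)
      }
    ; surjective = λ t → let φ , r = represents-onto t in φ , λ {ψ} → represents-reflect-≡ (rep ψ) r
    }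
    where
    rep : ∀ φ → Represents φ (classify φ)
    rep φ = proj₂ (represented φ)

module _ (em : ExcludedMiddle 0ℓ) (C : Pred ℕ 0ℓ) (cohesive : Cohesive C) where
  open Construction em
  open PowerFacts em C cohesive

  powerHeights : EventualOrder
  powerHeights = record
    { Ev          = Ev
    ; Ev-map₂     = Ev-map₂
    ; Ev-always   = Ev-always
    ; Ev-proper   = Ev-proper
    ; Carrier     = D
    ; height      = height
    ; trichotomy  = trichotomy
    ; zeroElement = zeroElement
    ; successor   = successor
    ; predecessor = predecessor
    ; dense       = λ {φ} {ψ} → dense {φ} {ψ}
    ; unbounded   = unbounded
    ; index       = λ φ → compile (code φ)
    ; index-inj   = λ {φ} {ψ} → compile-injective {φ} {ψ}
    }

  power≅ℕ+ℚ×ℤ : Π C order ≅ ℕ+ℚ×ℤ-order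
  power≅ℕ+ℚ×ℤ = classify , record
    { isOrderMonomorphism = record
      { isOrderHomomorphism = record
        { cong = λ {φ} {ψ} eq → respects {φ} {ψ} (=C⇒heights-equal {φ} {ψ} eq)
        ; mono = λ {φ} {ψ} lt → mono {φ} {ψ} (<C⇒heights-less {φ} {ψ} lt)
        }
      ; injective = λ {φ} {ψ} eq → heights-equal⇒=C {φ} {ψ} (injective {φ} {ψ} eq)
      ; cancel    = λ {φ} {ψ} lt → heights-less⇒<C {φ} {ψ} (cancel {φ} {ψ} lt)
      }
    ; surjective = λ t → let φ , onto = surjective t in φ , λ {ψ} eq → onto {ψ} (=C⇒heights-equal {ψ} {φ} eq)
    }
    where
    open OrderType em powerHeights using (classify; classify-isOrderIsomorphism)
    open IsOrderIsomorphism classify-isOrderIsomorphism using (mono; injective; cancel; surjective)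
      renaming (cong to respects)

theorem8 : ExcludedMiddle 0ℓ →
    ∃ λ (L : ComputableLinearOrder) →
    (ComputableLinearOrder.order L ≅ ℕ-order) ×
    (¬ ComputableLinearOrder.ComputableSuccessor L) ×
    (∀ (C : Pred ℕ 0ℓ) → Cohesive C → Π C L ≅ ℕ+ℚ×ℤ-order)
theorem8 em = order , order≅ℕ , ¬computableSuccessor , power≅ℕ+ℚ×ℤ em
  where open Construction em
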